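{- For each positive integer $n$, place $n$ hyper-bishops at random on the $3$-dimensional chessboard with side length $n$, and let $\mu_{n,3}$ be the expected proportion of safe spaces. Then in the limit $n\to\infty$ the expected proportion of safe spaces lies between $1/e^3$ and $1/e^{3/2}$, that is, $$\frac{1}{e^{3}}\le \liminf_{n\to\infty}\mu_{n,3}\le\limsup_{n\to\infty}\mu_{n,3}\le \frac{1}{e^{3/2}}.$$
   Context: The $3$-dimensional board of side length $n$ is the set of spaces $\{1,\dots,n\}^3$. "Placing $n$ pieces at random" means that the set of occupied spaces (the board configuration) is chosen uniformly among all $\binom{n^3}{n}$ subsets of $n$ distinct spaces. A hyper-bishop at $(a_1,a_2,a_3)$ attacks a space $(x_1,x_2,x_3)$ if $(x_1-a_1)\pm(x_2-a_2)\pm(x_3-a_3)=0$ for some choice of the two signs. A space is safe under a board configuration if it is neither occupied nor attacked by any of the placed pieces. The expected proportion of safe spaces $\mu_{n,3}$ is the expected number of safe spaces divided by $n^3$. -}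

module Defs where

open import Data.Fin.Base using (Fin; toℕ)
import Data.Fin.Properties as Fin
open import Data.Integer.Base as ℤ using (ℤ; +_; 0ℤ)
import Data.Integer.Properties as ℤ
open import Data.List.Base
  using (List; []; _∷_; [_]; _++_; map; filter; length; allFin; cartesianProduct)
import Data.List.Properties as List
open import Data.List.Membership.Propositional using (_∉_)
import Data.List.Membership.DecPropositional as DecMembership
open import Data.List.Relation.Unary.All as All using (All)
open import Data.Nat.Base as ℕ using (ℕ; zero; suc; z≤n; s≤s; _!)
import Data.Nat.Properties as ℕ
open import Data.Nat.ListAction using (sum)
open import Data.Nat.Combinatorics using (_C_; nCk+nC[k+1]≡[n+1]C[k+1])
open import Data.Product.Base using (∃-syntax; _×_; _,_; proj₁; proj₂)
import Data.Product.Properties as Product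
open import Data.Rational.Base as ℚ hiding (NonZero; _>_; truncate)
import Data.Rational.Properties as ℚ
import Data.Rational.Unnormalised.Base as ℚᵘ
import Data.Rational.Unnormalised.Properties as ℚᵘ
open import Data.Rational.Solver using (module +-*-Solver)
open import Data.Sum.Base using (_⊎_; inj₁; inj₂)
open import Level using (0ℓ)
open import Relation.Binary.Definitions using (DecidableEquality)
open import Relation.Binary.PropositionalEquality
  using (_≡_; refl; sym; trans; cong; cong₂; subst; subst₂)
open import Relation.Nullary.Decidable.Core using (Dec; ¬?; _×-dec_; _⊎-dec_)
open import Relation.Nullary.Negation.Core using (¬_)
open import Relation.Unary using (Pred; _∈_; _⊆_)
open import Algebra.Definitions.RawSemiring ℚ.+-*-rawSemiring using (_^_)

Space : ℕ → Set
Space n = Fin n × Fin n × Fin n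

_≟ˢ_ : ∀ {n} → DecidableEquality (Space n)
_≟ˢ_ = Product.≡-dec Fin._≟_ (Product.≡-dec Fin._≟_ Fin._≟_)

-- Fin n starts at 0, the board's coordinates at 1.
coord : ∀ {n} → Fin n → ℤ
coord i = + suc (toℕ i)

Attacks : ∀ {n} → Space n → Space n → Set
Attacks (a₁ , a₂ , a₃) (x₁ , x₂ , x₃) =
  (d₁ ℤ.+ d₂ ℤ.+ d₃ ≡ 0ℤ) ⊎ (d₁ ℤ.+ d₂ ℤ.- d₃ ≡ 0ℤ) ⊎
  (d₁ ℤ.- d₂ ℤ.+ d₃ ≡ 0ℤ) ⊎ (d₁ ℤ.- d₂ ℤ.- d₃ ≡ 0ℤ)
  where
  d₁ = coord x₁ ℤ.- coord a₁
  d₂ = coord x₂ ℤ.- coord a₂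
  d₃ = coord x₃ ℤ.- coord a₃

attacks? : ∀ {n} (a x : Space n) → Dec (Attacks a x)
attacks? _ _ = (_ ℤ.≟ _) ⊎-dec (_ ℤ.≟ _) ⊎-dec (_ ℤ.≟ _) ⊎-dec (_ ℤ.≟ _)

Safe : ∀ {n} → List (Space n) → Space n → Set
Safe c x = x ∉ c × All (λ a → ¬ Attacks a x) c

safe? : ∀ {n} (c : List (Space n)) (x : Space n) → Dec (Safe c x)
safe? c x = ¬? (x ∈? c) ×-dec All.all? (λ a → ¬? (attacks? a x)) c
  where open DecMembership _≟ˢ_ using (_∈?_)

spaces : ∀ n → List (Space n)
spaces n = cartesianProduct (allFin n) (cartesianProduct (allFin n) (allFin n))

numSafe : ∀ {n} → List (Space n) → ℕ
numSafe c = length (filter (safe? c) (spaces _))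

-- The sublists of length k. When the list has no repeated entry, these
-- represent each k-element subset of its entries exactly once.
choose : {A : Set} → ℕ → List A → List (List A)
choose zero    xs       = [ [] ]
choose (suc k) []       = []
choose (suc k) (x ∷ xs) = map (x ∷_) (choose k xs) ++ choose (suc k) xs

configurations : ∀ n → List (List (Space n))
configurations n = choose n (spaces n)

length-choose : {A : Set} (k : ℕ) (xs : List A) →
                length (choose k xs) ≡ length xs C k
length-choose zero    xs       = refl
length-choose (suc k) []       = refl
length-choose (suc k) (x ∷ xs) = trans
  (List.length-++ (map (x ∷_) (choose k xs)))
  (trans (cong₂ ℕ._+_
           (trans (List.length-map (x ∷_) (choose k xs)) (length-choose k xs))
           (length-choose (suc k) xs))
         (nCk+nC[k+1]≡[n+1]C[k+1] (length xs) k))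

length-cartesianProduct : {A B : Set} (xs : List A) (ys : List B) →
  length (cartesianProduct xs ys) ≡ length xs ℕ.* length ys
length-cartesianProduct []       ys = refl
length-cartesianProduct (x ∷ xs) ys = trans (List.length-++ (map (x ,_) ys))
  (cong₂ ℕ._+_ (List.length-map (x ,_) ys) (length-cartesianProduct xs ys))

length-spaces : ∀ n → length (spaces n) ≡ n ℕ.^ 3
length-spaces n =
  trans (length-cartesianProduct (allFin n) (cartesianProduct (allFin n) (allFin n)))
  (cong₂ ℕ._*_ (List.length-tabulate {n = n} (λ i → i))
    (trans (length-cartesianProduct (allFin n) (allFin n))
      (cong₂ ℕ._*_ (List.length-tabulate {n = n} (λ i → i))
        (trans (List.length-tabulate {n = n} (λ i → i)) (sym (ℕ.*-identityʳ n))))))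

length-configurations : ∀ n → length (configurations n) ≡ (n ℕ.^ 3) C n
length-configurations n =
  trans (length-choose n (spaces n)) (cong (_C n) (length-spaces n))

n^3≢0 : ∀ n .{{_ : ℕ.NonZero n}} → ℕ.NonZero (n ℕ.^ 3)
n^3≢0 n = ℕ.m^n≢0 n 3

configurations≢0 : ∀ n .{{_ : ℕ.NonZero n}} → ℕ.NonZero (length (configurations n))
configurations≢0 n = ℕ.>-nonZero (subst (0 ℕ.<_) (sym (length-choose n (spaces n)))
    (C>0 (length (spaces n)) n (subst (n ℕ.≤_) (sym (length-spaces n)) n≤n^3)))
  where
  C>0 : ∀ m k → k ℕ.≤ m → 0 ℕ.< m C k
  C>0 m       zero    _         = s≤s z≤n
  C>0 (suc m) (suc k) (s≤s k≤m) =
    subst (0 ℕ.<_) (nCk+nC[k+1]≡[n+1]C[k+1] m k)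
      (ℕ.≤-trans (C>0 m k k≤m) (ℕ.m≤m+n (m C k) (m C suc k)))
  n≤n^3 : n ℕ.≤ n ℕ.^ 3
  n≤n^3 = ℕ.m≤m*n n (n ℕ.^ 2) {{ℕ.m^n≢0 n 2}}

-- Expectation of f at an entry of xs chosen uniformly.
𝔼 : {A : Set} (xs : List A) .{{_ : ℕ.NonZero (length xs)}} → (A → ℕ) → ℚ
𝔼 xs f = + sum (map f xs) / length xs

μ : (n : ℕ) .{{_ : ℕ.NonZero n}} → ℚ
μ n = 𝔼 (configurations n) {{configurations≢0 n}} numSafe
      * (+ 1 / (n ℕ.^ 3)) {{n^3≢0 n}}

-- Constructively, the limit inferior of a sequence of rationals is only
-- given by the rationals below it and the limit superior by those above.
-- Cuts may be empty or full, so these are extended reals.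

record LowerReal : Set₁ where
  field
    below   : Pred ℚ 0ℓ
    closed  : ∀ {q r} → q < r → r ∈ below → q ∈ below
    rounded : ∀ {q} → q ∈ below → ∃[ r ] q < r × r ∈ below

record UpperReal : Set₁ where
  field
    above   : Pred ℚ 0ℓ
    closed  : ∀ {q r} → q < r → q ∈ above → r ∈ above
    rounded : ∀ {r} → r ∈ above → ∃[ q ] q < r × q ∈ above

open LowerReal using (below)
open UpperReal using (above)

infix 4 _≤ᴸ_ _≤ᵁ_ _≤ᴸᵁ_

_≤ᴸ_ : LowerReal → LowerReal → Set
x ≤ᴸ y = below x ⊆ below y

_≤ᵁ_ : UpperReal → UpperReal → Set
x ≤ᵁ y = above y ⊆ above x

_≤ᴸᵁ_ : LowerReal → UpperReal → Set
x ≤ᴸᵁ y = ∀ {q r} → q ∈ below x → r ∈ above y → q < r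

inf : (ℕ → ℚ) → LowerReal
inf a = record
  { below   = λ q → ∃[ s ] q < s × ∀ n → s ≤ a n
  ; closed  = λ { q<r (s , r<s , s≤a) → s , ℚ.<-trans q<r r<s , s≤a }
  ; rounded = λ { (s , q<s , s≤a) → let (r , q<r , r<s) = ℚ.<-dense q<s in
                                    r , q<r , s , r<s , s≤a }
  }

sup : (ℕ → ℚ) → UpperReal
sup a = record
  { above   = λ r → ∃[ s ] s < r × ∀ n → a n ≤ s
  ; closed  = λ { q<r (s , s<q , a≤s) → s , ℚ.<-trans s<q q<r , a≤s }
  ; rounded = λ { (s , s<r , a≤s) → let (q , s<q , q<r) = ℚ.<-dense s<r in
                                    q , q<r , s , s<q , a≤s }
  }

⋁ : (ℕ → LowerReal) → LowerReal
⋁ x = record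
  { below   = λ q → ∃[ N ] q ∈ below (x N)
  ; closed  = λ { q<r (N , r∈) → N , LowerReal.closed (x N) q<r r∈ }
  ; rounded = λ { (N , q∈) → let (r , q<r , r∈) = LowerReal.rounded (x N) q∈ in
                             r , q<r , N , r∈ }
  }

⋀ : (ℕ → UpperReal) → UpperReal
⋀ x = record
  { above   = λ r → ∃[ N ] r ∈ above (x N)
  ; closed  = λ { q<r (N , q∈) → N , UpperReal.closed (x N) q<r q∈ }
  ; rounded = λ { (N , r∈) → let (q , q<r , q∈) = UpperReal.rounded (x N) r∈ in
                             q , q<r , N , q∈ }
  }

liminf : (ℕ → ℚ) → LowerReal
liminf a = ⋁ λ N → inf λ n → a (N ℕ.+ n)

limsup : (ℕ → ℚ) → UpperReal
limsup a = ⋀ λ N → sup λ n → a (N ℕ.+ n)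

record ℝ : Set where
  field
    seq    : ℕ → ℚ
    cauchy : ∀ ε → 0ℚ < ε →
             ∃[ N ] ∀ m n → N ℕ.≤ m → N ℕ.≤ n → ∣ seq m - seq n ∣ < ε

open ℝ using (seq; cauchy)

-- The rationals below (above) a real are those below the limit inferior
-- (above the limit superior) of any sequence converging to it.
lower : ℝ → LowerReal
lower x = liminf (seq x)

upper : ℝ → UpperReal
upper x = limsup (seq x)

Positiveᴿ : ℝ → Set
Positiveᴿ x = 0ℚ ∈ below (lower x)

private
  *-monoˡ : ∀ {p q r} → 0ℚ ≤ r → p ≤ q → r * p ≤ r * q
  *-monoˡ {r = r} 0≤r = ℚ.*-monoˡ-≤-nonNeg r {{nonNegative 0≤r}}

  *-monoʳ : ∀ {p q r} → 0ℚ ≤ r → p ≤ q → p * r ≤ q * r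
  *-monoʳ {r = r} 0≤r = ℚ.*-monoʳ-≤-nonNeg r {{nonNegative 0≤r}}

  0<1/ : ∀ {p} (0<p : 0ℚ < p) → 0ℚ < (1/ p) {{>-nonZero 0<p}}
  0<1/ {p} 0<p = ℚ.positive⁻¹ _ {{ℚ.1/pos⇒pos p {{positive 0<p}}}}

  1/-diff : ∀ p q .{{_ : ℚ.NonZero p}} .{{_ : ℚ.NonZero q}} →
            1/ p - 1/ q ≡ 1/ p * (q - p) * 1/ q
  1/-diff p q = sym (trans
      (solve 4 (λ p q p′ q′ → p′ :* (q :- p) :* q′ := p′ :* (q :* q′) :- (p′ :* p) :* q′)
         refl p q (1/ p) (1/ q))
      (cong₂ _-_ (trans (cong (1/ p *_) (ℚ.*-inverseʳ q)) (ℚ.*-identityʳ (1/ p)))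
                 (trans (cong (_* 1/ q) (ℚ.*-inverseˡ p)) (ℚ.*-identityˡ (1/ q)))))
    where open +-*-Solver

  1/-anti : ∀ {p q} .{{_ : ℚ.NonZero p}} .{{_ : ℚ.NonZero q}} →
            0ℚ < p → p ≤ q → 1/ q ≤ 1/ p
  1/-anti {p} {q} 0<p p≤q = subst₂ _≤_ l r
      (*-monoʳ {r = 1/ q} 0≤1/q (*-monoˡ {r = 1/ p} (ℚ.<⇒≤ (0<1/ 0<p)) p≤q))
    where
    0≤1/q : 0ℚ ≤ 1/ q
    0≤1/q = ℚ.<⇒≤ (0<1/ (ℚ.<-≤-trans 0<p p≤q))
    l : 1/ p * p * 1/ q ≡ 1/ q
    l = trans (cong (_* 1/ q) (ℚ.*-inverseˡ p)) (ℚ.*-identityˡ (1/ q))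
    r : 1/ p * q * 1/ q ≡ 1/ p
    r = trans (ℚ.*-assoc (1/ p) q (1/ q))
              (trans (cong (1/ p *_) (ℚ.*-inverseʳ q)) (ℚ.*-identityʳ (1/ p)))

-- Positivity provides N and s > 0 with s ≤ seq x n for all n ≥ N; the
-- reciprocal inverts the sequence from N on.
recip : (x : ℝ) → Positiveᴿ x → ℝ
recip x (N , s , 0<s , s≤x) = record { seq = y ; cauchy = y-cauchy }
  where
  x′ : ℕ → ℚ
  x′ n = seq x (N ℕ.+ n)

  0<x′ : ∀ n → 0ℚ < x′ n
  0<x′ n = ℚ.<-≤-trans 0<s (s≤x n)

  y : ℕ → ℚ
  y n = (1/ x′ n) {{>-nonZero (0<x′ n)}}

  y-cauchy : ∀ ε → 0ℚ < ε →
             ∃[ M ] ∀ m n → M ℕ.≤ m → M ℕ.≤ n → ∣ y m - y n ∣ < ε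
  y-cauchy ε 0<ε = M , λ m n M≤m M≤n → ℚ.≤-<-trans (bound m n)
      (subst (s⁻¹ * ∣ x′ n - x′ m ∣ * s⁻¹ <_) s⁻¹δs⁻¹≡ε
        (ℚ.*-monoˡ-<-pos s⁻¹ {{s⁻¹>0}} (ℚ.*-monoʳ-<-pos s⁻¹ {{s⁻¹>0}}
          (isM (N ℕ.+ n) (N ℕ.+ m) (ℕ.≤-trans M≤n (ℕ.m≤n+m n N)) (ℕ.≤-trans M≤m (ℕ.m≤n+m m N))))))
    where
    instance
      _ = >-nonZero 0<s
    s⁻¹ = 1/ s
    s⁻¹>0 : Positive s⁻¹
    s⁻¹>0 = ℚ.1/pos⇒pos s {{positive 0<s}}
    δ = s * ε * s
    0<δ : 0ℚ < δ
    0<δ = ℚ.positive⁻¹ δ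
      {{ℚ.pos*pos⇒pos (s * ε) {{ℚ.pos*pos⇒pos s {{positive 0<s}} ε {{positive 0<ε}}}} s {{positive 0<s}}}}
    M   = proj₁ (cauchy x δ 0<δ)
    isM = proj₂ (cauchy x δ 0<δ)

    s⁻¹δs⁻¹≡ε : s⁻¹ * δ * s⁻¹ ≡ ε
    s⁻¹δs⁻¹≡ε = trans
      (solve 3 (λ s e i → i :* (s :* e :* s) :* i := (i :* s) :* e :* (i :* s)) refl s ε s⁻¹)
      (trans (cong₂ (λ a b → a * ε * b) (ℚ.*-inverseˡ s) (ℚ.*-inverseˡ s))
             (trans (ℚ.*-identityʳ _) (ℚ.*-identityˡ ε)))
      where open +-*-Solver

    y≥0 : ∀ n → 0ℚ ≤ y n
    y≥0 n = ℚ.<⇒≤ (0<1/ (0<x′ n))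

    y≤s⁻¹ : ∀ n → y n ≤ s⁻¹
    y≤s⁻¹ n = 1/-anti {{_}} {{>-nonZero (0<x′ n)}} 0<s (s≤x n)

    bound : ∀ m n → ∣ y m - y n ∣ ≤ s⁻¹ * ∣ x′ n - x′ m ∣ * s⁻¹
    bound m n = ℚ.≤-trans (ℚ.≤-reflexive eq) (ℚ.≤-trans
        (*-monoʳ {r = y n} (y≥0 n) (*-monoʳ (ℚ.0≤∣p∣ _) (y≤s⁻¹ m)))
        (*-monoˡ {r = s⁻¹ * ∣ x′ n - x′ m ∣} 0≤ (y≤s⁻¹ n)))
      where
      0≤ : 0ℚ ≤ s⁻¹ * ∣ x′ n - x′ m ∣
      0≤ = subst (_≤ s⁻¹ * ∣ x′ n - x′ m ∣) (ℚ.*-zeroʳ s⁻¹)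
             (*-monoˡ {r = s⁻¹} (ℚ.<⇒≤ (0<1/ 0<s)) (ℚ.0≤∣p∣ _))
      eq : ∣ y m - y n ∣ ≡ y m * ∣ x′ n - x′ m ∣ * y n
      eq = trans (cong ∣_∣ (1/-diff (x′ m) (x′ n) {{>-nonZero (0<x′ m)}} {{>-nonZero (0<x′ n)}}))
         (trans (ℚ.∣p*q∣≡∣p∣*∣q∣ (y m * (x′ n - x′ m)) (y n))
          (cong₂ _*_ (trans (ℚ.∣p*q∣≡∣p∣*∣q∣ (y m) (x′ n - x′ m))
                            (cong (_* ∣ x′ n - x′ m ∣) (ℚ.0≤p⇒∣p∣≡p (y≥0 m))))
                     (ℚ.0≤p⇒∣p∣≡p (y≥0 n))))

expTerm : ℚ → ℕ → ℚ
expTerm x k = x ^ k * (+ 1 / (k !)) {{k ℕ.!≢0}}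

expSum : ℚ → ℕ → ℚ
expSum x zero    = expTerm x 0
expSum x (suc n) = expSum x n + expTerm x (suc n)

private
  fromℕ : ℕ → ℚ
  fromℕ n = + n / 1

  toℚᵘ-/ : ∀ i n .{{_ : ℕ.NonZero n}} → toℚᵘ (i / n) ℚᵘ.≃ (i ℚᵘ./ n)
  toℚᵘ-/ i (suc n) = ℚ.toℚᵘ-fromℚᵘ (ℚᵘ.mkℚᵘ i n)

  1/mn : ∀ m n .{{_ : ℕ.NonZero m}} .{{_ : ℕ.NonZero n}} .{{_ : ℕ.NonZero (m ℕ.* n)}} →
         + 1 / (m ℕ.* n) ≡ (+ 1 / m) * (+ 1 / n)
  1/mn (suc m) (suc n) = ℚ.toℚᵘ-injective (ℚᵘ.≃-trans (toℚᵘ-/ (+ 1) (suc m ℕ.* suc n))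
    (ℚᵘ.≃-sym (ℚᵘ.≃-trans (ℚ.toℚᵘ-homo-* (+ 1 / suc m) (+ 1 / suc n))
      (ℚᵘ.≃-trans (ℚᵘ.*-cong (toℚᵘ-/ (+ 1) (suc m)) (toℚᵘ-/ (+ 1) (suc n)))
                  (ℚᵘ.*≡* refl)))))

  n*1/n : ∀ n .{{_ : ℕ.NonZero n}} → fromℕ n * (+ 1 / n) ≡ 1ℚ
  n*1/n (suc n) = ℚ.toℚᵘ-injective
    (ℚᵘ.≃-trans (ℚ.toℚᵘ-homo-* (fromℕ (suc n)) (+ 1 / suc n))
      (ℚᵘ.≃-trans (ℚᵘ.*-cong (toℚᵘ-/ (+ suc n) 1) (toℚᵘ-/ (+ 1) (suc n)))
        (ℚᵘ.*≡* (trans (ℤ.*-identityʳ _) (trans (ℤ.*-identityʳ _)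
          (sym (trans (ℤ.*-identityˡ _) (cong +_ (ℕ.+-identityʳ (suc n))))))))))

  0<1/n : ∀ n .{{_ : ℕ.NonZero n}} → 0ℚ < + 1 / n
  0<1/n (suc n) = ℚ.positive⁻¹ _ {{ℚ.normalize-pos 1 (suc n)}}

  fromℕ-mono : ∀ {m n} → m ℕ.≤ n → fromℕ m ≤ fromℕ n
  fromℕ-mono {m} {n} m≤n = ℚ.toℚᵘ-cancel-≤
    (ℚᵘ.≤-trans (ℚᵘ.≤-reflexive (toℚᵘ-/ (+ m) 1))
      (ℚᵘ.≤-trans (ℚᵘ.*≤* (ℤ.*-monoʳ-≤-nonNeg (+ 1) (ℤ.+≤+ m≤n)))
                  (ℚᵘ.≤-reflexive (ℚᵘ.≃-sym (toℚᵘ-/ (+ n) 1)))))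

  ceil : ℚ → ℕ
  ceil p = ℤ.∣ ↥ p ∣

  ≤ceil : ∀ p → p ≤ fromℕ (ceil p)
  ≤ceil p@(mkℚ i d _) = ℚ.toℚᵘ-cancel-≤
    (ℚᵘ.≤-trans (ℚᵘ.*≤* (le i)) (ℚᵘ.≤-reflexive (ℚᵘ.≃-sym (toℚᵘ-/ (+ ℤ.∣ i ∣) 1))))
    where
    le : ∀ i → i ℤ.* + 1 ℤ.≤ + ℤ.∣ i ∣ ℤ.* + suc d
    le (+ n)       = subst₂ ℤ._≤_ (sym (ℤ.*-identityʳ (+ n))) (ℤ.pos-* n (suc d))
                       (ℤ.+≤+ (ℕ.m≤m*n n (suc d)))
    le (ℤ.-[1+ n ]) = ℤ.-≤+

module _ (x : ℚ) where
  private
    t : ℕ → ℚ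
    t = expTerm x

    S : ℕ → ℚ
    S = expSum x

    u : ℕ → ℚ
    u k = ∣ t k ∣

    0≤u : ∀ k → 0ℚ ≤ u k
    0≤u k = ℚ.0≤∣p∣ (t k)

    t-suc : ∀ k → t (suc k) ≡ (+ 1 / suc k) * (x * t k)
    t-suc k = trans
      (cong (x ^ suc k *_) (1/mn (suc k) (k !) {{_}} {{k ℕ.!≢0}} {{suc k ℕ.!≢0}}))
      (solve 4 (λ x p a b → (x :* p) :* (a :* b) := a :* (x :* (p :* b)))
         refl x (x ^ k) (+ 1 / suc k) ((+ 1 / (k !)) {{k ℕ.!≢0}}))
      where open +-*-Solver

    u-suc : ∀ k → u (suc k) ≡ (+ 1 / suc k) * (∣ x ∣ * u k)
    u-suc k = trans (cong ∣_∣ (t-suc k))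
      (trans (ℚ.∣p*q∣≡∣p∣*∣q∣ (+ 1 / suc k) (x * t k))
        (cong₂ _*_ (ℚ.0≤p⇒∣p∣≡p (ℚ.<⇒≤ (0<1/n (suc k)))) (ℚ.∣p*q∣≡∣p∣*∣q∣ x (t k))))

    K : ℕ
    K = ceil (∣ x ∣ + ∣ x ∣)

    u-halves : ∀ k → K ℕ.≤ k → u (suc k) + u (suc k) ≤ u k
    u-halves k K≤k = subst₂ _≤_ (sym l) r
        (*-monoˡ {r = + 1 / suc k} (ℚ.<⇒≤ (0<1/n (suc k))) (*-monoʳ {r = u k} (0≤u k) 2x≤k+1))
      where
      open +-*-Solver
      2x≤k+1 : ∣ x ∣ + ∣ x ∣ ≤ fromℕ (suc k)
      2x≤k+1 = ℚ.≤-trans (≤ceil (∣ x ∣ + ∣ x ∣)) (fromℕ-mono (ℕ.m≤n⇒m≤1+n K≤k))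
      l : u (suc k) + u (suc k) ≡ (+ 1 / suc k) * ((∣ x ∣ + ∣ x ∣) * u k)
      l = trans (cong₂ _+_ (u-suc k) (u-suc k))
            (solve 3 (λ a x u → a :* (x :* u) :+ a :* (x :* u) := a :* ((x :+ x) :* u))
               refl (+ 1 / suc k) ∣ x ∣ (u k))
      r : (+ 1 / suc k) * (fromℕ (suc k) * u k) ≡ u k
      r = trans (solve 3 (λ a b u → a :* (b :* u) := (b :* a) :* u)
                   refl (+ 1 / suc k) (fromℕ (suc k)) (u k))
                (trans (cong (_* u k) (n*1/n (suc k))) (ℚ.*-identityˡ (u k)))

    p≤p+p : ∀ {p} → 0ℚ ≤ p → p ≤ p + p
    p≤p+p {p} 0≤p = subst (_≤ p + p) (ℚ.+-identityʳ p) (ℚ.+-monoʳ-≤ p 0≤p)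

    u-decr : ∀ k j → K ℕ.≤ k → u (j ℕ.+ k) ≤ u k
    u-decr k zero    K≤k = ℚ.≤-refl
    u-decr k (suc j) K≤k = ℚ.≤-trans (p≤p+p (0≤u (suc (j ℕ.+ k))))
      (ℚ.≤-trans (u-halves (j ℕ.+ k) (ℕ.≤-trans K≤k (ℕ.m≤n+m k j))) (u-decr k j K≤k))

    S-diff : ∀ n j → K ℕ.≤ n → ∣ S (j ℕ.+ n) - S n ∣ + u (j ℕ.+ n) ≤ u n
    S-diff n zero    K≤n = ℚ.≤-reflexive
      (trans (cong (λ p → ∣ p ∣ + u n) (ℚ.+-inverseʳ (S n))) (ℚ.+-identityˡ (u n)))
    S-diff n (suc j) K≤n = ℚ.≤-trans (ℚ.+-monoˡ-≤ v step) (ℚ.≤-trans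
        (ℚ.≤-reflexive (ℚ.+-assoc ∣ S m - S n ∣ v v))
        (ℚ.≤-trans (ℚ.+-monoʳ-≤ ∣ S m - S n ∣ (u-halves m (ℕ.≤-trans K≤n (ℕ.m≤n+m n j))))
                   (S-diff n j K≤n)))
      where
      open +-*-Solver
      m = j ℕ.+ n
      v = u (suc m)
      step : ∣ S (suc m) - S n ∣ ≤ ∣ S m - S n ∣ + v
      step = subst (λ p → ∣ p ∣ ≤ ∣ S m - S n ∣ + v)
        (solve 3 (λ a b c → (a :- b) :+ c := (a :+ c) :- b) refl (S m) (S n) (t (suc m)))
        (ℚ.∣p+q∣≤∣p∣+∣q∣ (S m - S n) (t (suc m)))

    S-tail : ∀ {m n} → K ℕ.≤ n → n ℕ.≤ m → ∣ S m - S n ∣ ≤ u n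
    S-tail {m} {n} K≤n n≤m = subst (λ m → ∣ S m - S n ∣ ≤ u n) (ℕ.m∸n+n≡m n≤m)
      (ℚ.≤-trans (subst (_≤ ∣ S m′ - S n ∣ + u m′) (ℚ.+-identityʳ _) (ℚ.+-monoʳ-≤ ∣ S m′ - S n ∣ (0≤u m′)))
                 (S-diff n (m ℕ.∸ n) K≤n))
      where m′ = m ℕ.∸ n ℕ.+ n

    module _ (ε : ℚ) (0<ε : 0ℚ < ε) where
      instance
        ε≢0 : ℚ.NonZero ε
        ε≢0 = >-nonZero 0<ε

      B : ℚ
      B = ∣ x ∣ * u K

      N : ℕ
      N = suc (ceil (B * 1/ ε) ℕ.+ K)

      B<Nε : B < fromℕ N * ε
      B<Nε = subst (_< fromℕ N * ε)
        (trans (ℚ.*-assoc B (1/ ε) ε) (trans (cong (B *_) (ℚ.*-inverseˡ ε)) (ℚ.*-identityʳ B)))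
        (ℚ.*-monoˡ-<-pos ε {{positive 0<ε}}
          (ℚ.≤-<-trans (≤ceil (B * 1/ ε)) (ℚ.≤-<-trans (fromℕ-mono (ℕ.m≤m+n (ceil (B * 1/ ε)) K))
            (fromℕ-suc (ceil (B * 1/ ε) ℕ.+ K)))))
        where
        fromℕ-suc : ∀ n → fromℕ n < fromℕ (suc n)
        fromℕ-suc n = ℚ.toℚᵘ-cancel-<
          (ℚᵘ.<-≤-trans (ℚᵘ.≤-<-trans (ℚᵘ.≤-reflexive (toℚᵘ-/ (+ n) 1))
              (ℚᵘ.*<* (ℤ.*-monoʳ-<-pos (+ 1) (ℤ.+<+ (ℕ.n<1+n n)))))
            (ℚᵘ.≤-reflexive (ℚᵘ.≃-sym (toℚᵘ-/ (+ suc n) 1))))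

      uN<ε : u N < ε
      uN<ε = subst₂ _<_ (sym (u-suc k)) r
        (ℚ.≤-<-trans (*-monoˡ {r = + 1 / N} (ℚ.<⇒≤ (0<1/n N))
                       (*-monoˡ {r = ∣ x ∣} (ℚ.0≤∣p∣ x) (u-decr K (ceil (B * 1/ ε)) ℕ.≤-refl)))
          (ℚ.*-monoʳ-<-pos (+ 1 / N) {{positive (0<1/n N)}} B<Nε))
        where
        k = ceil (B * 1/ ε) ℕ.+ K
        r : (+ 1 / N) * (fromℕ N * ε) ≡ ε
        r = trans (sym (ℚ.*-assoc (+ 1 / N) (fromℕ N) ε))
              (trans (cong (_* ε) (trans (ℚ.*-comm (+ 1 / N) (fromℕ N)) (n*1/n N)))
                     (ℚ.*-identityˡ ε))

      K≤N : K ℕ.≤ N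
      K≤N = ℕ.m≤n⇒m≤1+n (ℕ.m≤n+m K _)

      near : ∀ {m n} → N ℕ.≤ n → n ℕ.≤ m → ∣ S m - S n ∣ < ε
      near {m} {n} N≤n n≤m = ℚ.≤-<-trans (S-tail (ℕ.≤-trans K≤N N≤n) n≤m)
        (ℚ.≤-<-trans (subst (λ n → u n ≤ u N) (ℕ.m∸n+n≡m N≤n) (u-decr N (n ℕ.∸ N) K≤N)) uN<ε)

      S-cauchy : ∀ m n → N ℕ.≤ m → N ℕ.≤ n → ∣ S m - S n ∣ < ε
      S-cauchy m n N≤m N≤n with ℕ.≤-total n m
      ... | inj₁ n≤m = near N≤n n≤m
      ... | inj₂ m≤n = subst (_< ε) flip (near N≤m m≤n)
        where
        flip : ∣ S n - S m ∣ ≡ ∣ S m - S n ∣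
        flip = trans (sym (ℚ.∣-p∣≡∣p∣ (S n - S m)))
          (cong ∣_∣ (solve 2 (λ a b → :- (a :- b) := b :- a) refl (S n) (S m)))
          where open +-*-Solver

  exp : ℝ
  exp = record { seq = S ; cauchy = λ ε 0<ε → N ε 0<ε , S-cauchy ε 0<ε }

exp-positive : ∀ x .{{_ : NonNegative x}} → Positiveᴿ (exp x)
exp-positive x = 0 , 1ℚ , *<* (ℤ.+<+ (s≤s z≤n)) , 1≤S
  where
  x^k≥0 : ∀ k → NonNegative (x ^ k)
  x^k≥0 zero    = _
  x^k≥0 (suc k) = ℚ.nonNeg*nonNeg⇒nonNeg x (x ^ k) {{x^k≥0 k}}

  t≥0 : ∀ k → 0ℚ ≤ expTerm x k
  t≥0 k = ℚ.nonNegative⁻¹ _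
    {{ℚ.nonNeg*nonNeg⇒nonNeg (x ^ k) {{x^k≥0 k}} _ {{ℚ.normalize-nonNeg 1 (k !) {{k ℕ.!≢0}}}}}}

  1≤S : ∀ n → 1ℚ ≤ expSum x n
  1≤S zero    = ℚ.≤-refl
  1≤S (suc n) = ℚ.≤-trans (1≤S n)
    (subst (_≤ expSum x (suc n)) (ℚ.+-identityʳ _) (ℚ.+-monoʳ-≤ (expSum x n) (t≥0 (suc n))))

1/e^_ : (x : ℚ) .{{_ : NonNegative x}} → ℝ
1/e^ x = recip (exp x) (exp-positive x)

{-# OPTIONS --safe #-}
module Submission where

-- A space x is safe exactly when all pieces avoid the A(x) spaces attacking x, so
-- μ n is the average over x of C(n³ - A(x), n) / C(n³, n), roughly exp(- A(x) / n²).
-- The spaces attacking x form four planes, any two of which meet in at most n spaces.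
-- A plane has at most 3n²/4 + O(n) spaces, hence A(x) ≤ 3n² + O(n). The planes through
-- x have together at least 3n²/2 spaces, with equality in the limit at a corner, hence
-- A(x) ≥ 3n²/2 - O(n). With E_K the partial sums of the exponential series, the powers
-- are compared to the exponential by (1 - t/n)ⁿ E_K(t) ≤ 1 and (1 + t/n)ⁿ ≤ E_n(t),
-- as (1 - t/n)ⁿ (1 + t/n)ⁿ ≥ 1 - t²/n.

open import Defs
open import Algebra.Bundles using (CommutativeRing)
open import Data.Bool.Base using (T)
open import Data.Fin.Base using (Fin; zero; suc; toℕ; opposite)
import Data.Fin.Permutation as Perm
import Data.Fin.Properties as Fin
open import Data.Integer.Base as ℤ using (ℤ; +_; -[1+_])
import Data.Integer.Properties as ℤ
open import Data.List.Base
  using (List; []; _∷_; _++_; map; filter; length; tabulate; cartesianProduct)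
import Data.List.Properties as List
open import Data.List.Relation.Unary.All as All using (All; []; _∷_)
open import Data.Nat.Base as ℕ using (ℕ; zero; suc; _!)
open import Data.Nat.Combinatorics using (_C_; nCk+nC[k+1]≡[n+1]C[k+1])
import Data.Nat.Properties as ℕ
open import Data.Product.Base using (∃-syntax; _×_; _,_; proj₁; proj₂)
open import Data.Rational.Base using (_/_)
import Data.Rational.Properties as ℚ
import Data.Rational.Unnormalised.Base as ℚᵘ
import Data.Rational.Unnormalised.Properties as ℚᵘ
open import Data.Sum.Base using (inj₁; inj₂)
open import Function.Base using (_∘_; id)
open import Level using (0ℓ)
open import Relation.Binary.PropositionalEquality
open import Relation.Nullary.Decidable.Core
  using (Dec; yes; no; ¬?; _×-dec_; _⊎-dec_; True; toWitness)
open import Relation.Nullary.Negation.Core using (¬_; contradiction)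
open import Relation.Unary using (Pred; Decidable)

-- The quotient C(m, n) / C(n³, n) is a product of n ratios (m - i) / (n³ - i), so it lies between
-- the n-th powers of (m - n) / (n³ - n) and m / n³. An error of order n in A(x), or the shift by n
-- in the lower power, changes one ratio only by a factor 1 - O(1/n²), and by Bernoulli the n-th
-- power of that factor is 1 - O(1/n). Crude linear error terms are therefore harmless. Fixing the
-- first coordinate cuts a plane into diagonals of lengths n - |t|, with t running through n
-- consecutive integers. Their total is largest when these are centred at 0, which gives n² - n²/4.
-- No such bound from below exists for a single plane, since at a corner one of the planes is a
-- single space; the four planes have to be estimated together. The truncation order of the
-- exponential differs on the two sides. A rational above 1/e^(3/2) is above 1/E_K for one suitable
-- K, which stays fixed while n grows. A rational below 1/e³ is below 1/E_K for all large K, hence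
-- also for K = n, the order that the estimate from below produces.

module Counting where

  open import Algebra.Properties.AbelianGroup ℤ.+-0-abelianGroup using (∙-cancelˡ)
  open import Algebra.Properties.Semiring.Sum ℤ.+-*-semiring
    using (sum; sum-syntax; sum-cong-≗; sum-replicate-zero; ∑-distrib-+; ∑-comm; ∑-permute; *-distribˡ-sum)
  open import Data.Integer.Base hiding (suc)
  open import Data.Integer.Properties
  open import Data.Integer.Tactic.RingSolver using (solve-∀)

  private variable
    n : ℕ
    A B P Q : Set

  -- Finite sums, indicators and counts of spaces.

  ∑-mono : {f g : Fin n → ℤ} → (∀ i → f i ≤ g i) → sum f ≤ sum g
  ∑-mono {zero}  f≤g = ≤-refl
  ∑-mono {suc n} f≤g = +-mono-≤ (f≤g zero) (∑-mono (f≤g ∘ suc))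

  ∑-const : ∀ n c → ∑[ i < n ] c ≡ + n * c
  ∑-const zero    c = refl
  ∑-const (suc n) c = trans (cong (_+_ c) (∑-const n c)) (sym (suc-* (+ n) c))

  ∑-zero : {f : Fin n → ℤ} → (∀ i → f i ≡ 0ℤ) → sum f ≡ 0ℤ
  ∑-zero {n} f≡0 = trans (sum-cong-≗ f≡0) (sum-replicate-zero n)

  𝟙 : Dec P → ℤ
  𝟙 (yes _) = 1ℤ
  𝟙 (no  _) = 0ℤ

  𝟙-yes : (d : Dec P) → P → 𝟙 d ≡ 1ℤ
  𝟙-yes (yes _) p = refl
  𝟙-yes (no ¬p) p = contradiction p ¬p

  𝟙-no : (d : Dec P) → ¬ P → 𝟙 d ≡ 0ℤ
  𝟙-no (yes p) ¬p = contradiction p ¬p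
  𝟙-no (no _)  ¬p = refl

  𝟙-cong : (d : Dec P) (e : Dec Q) → (P → Q) → (Q → P) → 𝟙 d ≡ 𝟙 e
  𝟙-cong (yes p) e to from = sym (𝟙-yes e (to p))
  𝟙-cong (no ¬p) e to from = sym (𝟙-no e (¬p ∘ from))

  ∑𝟙-unique : {P : Pred (Fin n) 0ℓ} (P? : Decidable P) → (∀ {i j} → P i → P j → i ≡ j) →
              ∑[ i < n ] 𝟙 (P? i) ≤ 1ℤ
  ∑𝟙-unique {zero}  P? uniq = +≤+ ℕ.z≤n
  ∑𝟙-unique {suc n} P? uniq with P? zero
  ... | yes p = ≤-reflexive (cong (_+_ 1ℤ)
                  (∑-zero λ i → 𝟙-no (P? (suc i)) λ q → contradiction (uniq p q) λ ()))
  ... | no  _ = ≤-trans (≤-reflexive (+-identityˡ _))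
                  (∑𝟙-unique (P? ∘ suc) λ p q → Fin.suc-injective (uniq p q))

  -- A row contributes at most the indicator that it contains a solution, and at most one row
  -- contains one.
  ∑∑𝟙-unique : ∀ {m n} {R : Fin m → Fin n → Set} (R? : ∀ i j → Dec (R i j)) →
               (∀ {i j i′ j′} → R i j → R i′ j′ → i ≡ i′ × j ≡ j′) →
               ∑[ i < m ] ∑[ j < n ] 𝟙 (R? i j) ≤ 1ℤ
  ∑∑𝟙-unique R? uniq = ≤-trans (∑-mono row)
      (∑𝟙-unique (λ i → Fin.any? (R? i)) λ { (_ , p) (_ , q) → proj₁ (uniq p q) })
    where
    row : ∀ i → sum (λ j → 𝟙 (R? i j)) ≤ 𝟙 (Fin.any? (R? i))
    row i with Fin.any? (R? i)
    ... | yes _ = ∑𝟙-unique (R? i) λ p q → proj₂ (uniq p q)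
    ... | no ¬∃ = ≤-reflexive (∑-zero λ j → 𝟙-no (R? i j) λ p → ¬∃ (j , p))

  count : {P : Pred A 0ℓ} → Decidable P → List A → ℕ
  count P? xs = length (filter P? xs)

  count-∷ : {P : Pred A 0ℓ} (P? : Decidable P) (x : A) (xs : List A) →
            + count P? (x ∷ xs) ≡ 𝟙 (P? x) + + count P? xs
  count-∷ P? x xs with P? x
  ... | yes _ = refl
  ... | no  _ = sym (+-identityˡ _)

  count-++ : {P : Pred A 0ℓ} (P? : Decidable P) (xs ys : List A) →
             count P? (xs ++ ys) ≡ count P? xs ℕ.+ count P? ys
  count-++ P? xs ys = trans (cong length (List.filter-++ P? xs ys)) (List.length-++ (filter P? xs))

  count-map : {P : Pred B 0ℓ} (P? : Decidable P) (f : A → B) (xs : List A) →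
              count P? (map f xs) ≡ count (P? ∘ f) xs
  count-map P? f []       = refl
  count-map P? f (x ∷ xs) with P? (f x)
  ... | yes _ = cong suc (count-map P? f xs)
  ... | no  _ = count-map P? f xs

  count-tabulate : {P : Pred A 0ℓ} (P? : Decidable P) (f : Fin n → A) →
                   + count P? (tabulate f) ≡ ∑[ i < n ] 𝟙 (P? (f i))
  count-tabulate {n = zero}  P? f = refl
  count-tabulate {n = suc n} P? f =
    trans (count-∷ P? (f zero) _) (cong (_+_ (𝟙 (P? (f zero)))) (count-tabulate P? (f ∘ suc)))

  count-cartesianProduct : {P : Pred (A × B) 0ℓ} (P? : Decidable P) (f : Fin n → A) (ys : List B) →
    + count P? (cartesianProduct (tabulate f) ys) ≡ ∑[ i < n ] (+ count (λ y → P? (f i , y)) ys)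
  count-cartesianProduct {n = zero}  P? f ys = refl
  count-cartesianProduct {n = suc n} P? f ys = trans
    (cong +_ (count-++ P? (map (f zero ,_) ys) _))
    (cong₂ _+_ (cong +_ (count-map P? (f zero ,_) ys)) (count-cartesianProduct P? (f ∘ suc) ys))

  count-spaces : {P : Pred (Space n) 0ℓ} (P? : Decidable P) →
    + count P? (spaces n) ≡ ∑[ a < n ] ∑[ b < n ] ∑[ c < n ] 𝟙 (P? (a , b , c))
  count-spaces {n} P? = trans (count-cartesianProduct P? id _) (sum-cong-≗ {n} λ a →
    trans (count-cartesianProduct (λ y → P? (a , y)) id _) (sum-cong-≗ {n} λ b →
      count-tabulate (λ c → P? (a , b , c)) id))

  -- The form in which polynomial inequalities are certified: the difference is written as a sum of
  -- products of quantities known to be nonnegative, and the ring solver checks the equation.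
  ≤-by : ∀ {i j c} → 0ℤ ≤ c → j - i ≡ c → i ≤ j
  ≤-by 0≤c eq = 0≤i-j⇒j≤i (≤-trans 0≤c (≤-reflexive (sym eq)))

  +-nonNeg : ∀ {i j} → 0ℤ ≤ i → 0ℤ ≤ j → 0ℤ ≤ i + j
  +-nonNeg = +-mono-≤

  *-nonNeg : ∀ {i j} → 0ℤ ≤ i → 0ℤ ≤ j → 0ℤ ≤ i * j
  *-nonNeg {i} {j} 0≤i 0≤j =
    ≤-trans (≤-reflexive (sym (*-zeroʳ i))) (*-monoˡ-≤-nonNeg i {{nonNegative 0≤i}} 0≤j)

  0≤+ : ∀ {n} → 0ℤ ≤ + n
  0≤+ = +≤+ ℕ.z≤n

  i≤+∣i∣ : ∀ i → i ≤ + ∣ i ∣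
  i≤+∣i∣ (+ n)    = ≤-refl
  i≤+∣i∣ -[1+ n ] = -≤+

  -i≤+∣i∣ : ∀ i → - i ≤ + ∣ i ∣
  -i≤+∣i∣ i = subst (λ k → - i ≤ + k) (∣-i∣≡∣i∣ i) (i≤+∣i∣ (- i))

  ∣i∣≤ : ∀ {i j} → i ≤ j → - i ≤ j → + ∣ i ∣ ≤ j
  ∣i∣≤ {+ n}    i≤j -i≤j = i≤j
  ∣i∣≤ { -[1+ n ]} i≤j -i≤j = -i≤j

  -- Diagonals of a square grid.

  ι : Fin n → ℤ
  ι i = + toℕ i

  -- The number of points of an n by n grid with b - c = t; truncated subtraction gives 0 for the
  -- diagonals that miss the grid.
  diag : ℕ → ℤ → ℤ
  diag n t = + (n ℕ.∸ ∣ t ∣)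

  ∑𝟙-≟ : ∀ n k → ∑[ i < n ] 𝟙 (ι i ≟ + k) ≡ 𝟙 (k ℕ.<? n)
  ∑𝟙-≟ zero    k       = sym (𝟙-no (k ℕ.<? 0) λ ())
  ∑𝟙-≟ (suc n) zero    = trans
    (cong₂ _+_ (𝟙-yes (+ 0 ≟ + 0) refl) (∑-zero {n} λ i → 𝟙-no (ι (suc i) ≟ + 0) λ ()))
    (sym (𝟙-yes (0 ℕ.<? suc n) (ℕ.s≤s ℕ.z≤n)))
  ∑𝟙-≟ (suc n) (suc k) = trans
    (cong₂ _+_ (𝟙-no (+ 0 ≟ + suc k) λ ())
      (trans (sum-cong-≗ {n} λ i → 𝟙-cong (ι (suc i) ≟ + suc k) (ι i ≟ + k)
               (λ eq → cong +_ (ℕ.suc-injective (+-injective eq))) (cong (_+_ 1ℤ)))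
             (∑𝟙-≟ n k)))
    (trans (+-identityˡ _) (𝟙-cong (k ℕ.<? n) (suc k ℕ.<? suc n) ℕ.s<s ℕ.s<s⁻¹))

  𝟙-<?-∸ : ∀ k n → 𝟙 (k ℕ.<? n) + + (n ℕ.∸ suc k) ≡ + (n ℕ.∸ k)
  𝟙-<?-∸ k n with k ℕ.<? n
  ... | yes k<n = cong +_ (sym (ℕ.+-∸-assoc 1 k<n))
  ... | no  k≮n = cong +_ (trans (ℕ.m≤n⇒m∸n≡0 (ℕ.m≤n⇒m≤1+n (ℕ.≮⇒≥ k≮n))) (sym (ℕ.m≤n⇒m∸n≡0 (ℕ.≮⇒≥ k≮n))))

  -- Induction peels off the first row and column of the grid of side `suc n`. Together they meet
  -- the diagonal `t` once if |t| ≤ n and never otherwise, which is the increment of `diag`.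
  ∑∑𝟙-difference : ∀ n t → ∑[ b < n ] ∑[ c < n ] 𝟙 (ι b - ι c ≟ t) ≡ diag n t
  ∑∑𝟙-difference zero    t = cong +_ (sym (ℕ.0∸n≡0 ∣ t ∣))
  ∑∑𝟙-difference (suc n) t = trans
    (cong (_+_ (𝟙 (0ℤ ≟ t) + row)) (trans (∑-distrib-+ {n} _ _) (cong (_+_ col) (trans
      (sum-cong-≗ {n} λ b → sum-cong-≗ {n} λ c → 𝟙-cong (ι (suc b) - ι (suc c) ≟ t) (ι b - ι c ≟ t)
        (trans (sym (shift (ι b) (ι c)))) (trans (shift (ι b) (ι c))))
      (∑∑𝟙-difference n t)))))
    (split t)
    where
    row = ∑[ c < n ] 𝟙 (0ℤ - ι (suc c) ≟ t)
    col = ∑[ b < n ] 𝟙 (ι (suc b) - 0ℤ ≟ t)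
    shift : ∀ i j → (1ℤ + i) - (1ℤ + j) ≡ i - j
    shift = solve-∀
    split : ∀ t → 𝟙 (0ℤ ≟ t) + ∑[ c < n ] 𝟙 (0ℤ - ι (suc c) ≟ t) +
                  (∑[ b < n ] 𝟙 (ι (suc b) - 0ℤ ≟ t) + diag n t) ≡ diag (suc n) t
    split (+ zero) = cong₂ _+_
      (cong₂ _+_ (𝟙-yes (0ℤ ≟ 0ℤ) refl) (∑-zero {n} λ c → 𝟙-no (0ℤ - ι (suc c) ≟ 0ℤ) λ ()))
      (trans (cong (_+ + n) (∑-zero {n} λ b → 𝟙-no (ι (suc b) - 0ℤ ≟ 0ℤ) λ ())) (+-identityˡ (+ n)))
    split (+ suc k) = trans (cong₂ _+_
        (cong₂ _+_ (𝟙-no (0ℤ ≟ + suc k) λ ()) (∑-zero {n} λ c → 𝟙-no (0ℤ - ι (suc c) ≟ + suc k) λ ()))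
        (cong (_+ diag n (+ suc k)) (trans
          (sum-cong-≗ {n} λ b → 𝟙-cong (ι (suc b) - 0ℤ ≟ + suc k) (ι b ≟ + k)
            (λ eq → cong +_ (ℕ.suc-injective (+-injective (trans (sym (+-identityʳ _)) eq))))
            (λ eq → trans (+-identityʳ _) (cong (_+_ 1ℤ) eq)))
          (∑𝟙-≟ n k))))
      (trans (+-identityˡ _) (𝟙-<?-∸ k n))
    split -[1+ k ] = trans (cong₂ _+_
        (trans (cong₂ _+_ (𝟙-no (0ℤ ≟ -[1+ k ]) λ ()) (trans
          (sum-cong-≗ {n} λ c → 𝟙-cong (0ℤ - ι (suc c) ≟ -[1+ k ]) (ι c ≟ + k)
            (λ eq → cong +_ (-[1+-injective eq)) (λ eq → cong (λ i → -[1+ ∣ i ∣ ]) eq))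
          (∑𝟙-≟ n k))) (+-identityˡ (𝟙 (k ℕ.<? n))))
        (trans (cong (_+ diag n -[1+ k ]) (∑-zero {n} λ b → 𝟙-no (ι (suc b) - 0ℤ ≟ -[1+ k ]) λ ()))
               (+-identityˡ (diag n -[1+ k ]))))
      (𝟙-<?-∸ k n)

  ι-opposite : (i : Fin n) → ι (opposite i) ≡ + n - 1ℤ - ι i
  ι-opposite {n} i = trans (cong +_ (Fin.opposite-prop i))
    (trans (sym (⊖-≥ (Fin.toℕ<n i))) (trans (sym (m-n≡m⊖n n (suc (toℕ i)))) (assoc (+ n) (ι i))))
    where
    assoc : ∀ n i → n - (1ℤ + i) ≡ n - 1ℤ - i
    assoc = solve-∀

  -- Reflecting c to n - 1 - c turns antidiagonals into diagonals; the longest antidiagonal, s = n -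
  -- 1, becomes the main diagonal.
  ∑∑𝟙-sum : ∀ n s → ∑[ b < n ] ∑[ c < n ] 𝟙 (ι b + ι c ≟ s) ≡ diag n (s - (+ n - 1ℤ))
  ∑∑𝟙-sum n s = trans
    (sum-cong-≗ {n} λ b → trans (∑-permute {n} {n} (λ c → 𝟙 (ι b + ι c ≟ s)) Perm.reverse)
      (sum-cong-≗ {n} λ c → 𝟙-cong (ι b + ι (opposite c) ≟ s) (ι b - ι c ≟ s - (+ n - 1ℤ))
        (λ eq → trans (to (ι b) (+ n) (ι c)) (cong (_- (+ n - 1ℤ)) (trans (cong (_+_ (ι b)) (sym (ι-opposite c))) eq)))
        (λ eq → trans (trans (cong (_+_ (ι b)) (ι-opposite c)) (from (ι b) (+ n) (ι c)))
                      (trans (cong (_+ (+ n - 1ℤ)) eq) (cancel s (+ n))))))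
    (∑∑𝟙-difference n _)
    where
    to : ∀ b n c → b - c ≡ (b + (n - 1ℤ - c)) - (n - 1ℤ)
    to = solve-∀
    from : ∀ b n c → b + (n - 1ℤ - c) ≡ (b - c) + (n - 1ℤ)
    from = solve-∀
    cancel : ∀ s n → s - (n - 1ℤ) + (n - 1ℤ) ≡ s
    cancel = solve-∀

  n-∣t∣≤diag : ∀ n t → + n - + ∣ t ∣ ≤ diag n t
  n-∣t∣≤diag n t = ≤-trans (≤-reflexive (m-n≡m⊖n n ∣ t ∣)) (m⊖n≤m∸n n ∣ t ∣)
    where
    m⊖n≤m∸n : ∀ m n → m ⊖ n ≤ + (m ℕ.∸ n)
    m⊖n≤m∸n m n with ℕ.≤-total n m
    ... | inj₁ n≤m = ≤-reflexive (⊖-≥ n≤m)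
    ... | inj₂ m≤n = ≤-trans (≤-reflexive (⊖-≤ m≤n)) (≤-trans (neg-mono-≤ 0≤+) 0≤+)

  diag≤ : ∀ {n t k} → k ℕ.≤ ∣ t ∣ → k ℕ.≤ n → diag n t ≤ + n - + k
  diag≤ {n} {t} {k} k≤∣t∣ k≤n = ≤-trans (+≤+ (ℕ.∸-monoʳ-≤ n k≤∣t∣))
    (≤-reflexive (trans (sym (⊖-≥ k≤n)) (sym (m-n≡m⊖n n k))))

  -- Sums of distances along a row, and the size of one plane.

  distances : ℕ → ℤ → ℤ
  distances n k = ∑[ a < n ] (+ ∣ k - ι a ∣)

  ∑-suc : ∀ n → + 2 * ∑[ a < n ] (1ℤ + ι a) ≡ + n * (+ n + 1ℤ)
  ∑-suc zero    = refl
  ∑-suc (suc n) = trans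
    (cong (λ s → + 2 * (1ℤ + s)) (trans (∑-distrib-+ {n} (λ _ → 1ℤ) (λ a → 1ℤ + ι a))
                                        (cong (_+ s) (∑-const n 1ℤ))))
    (trans (step₁ (+ n) s) (trans (cong (_+_ (+ 2 * (1ℤ + + n))) (∑-suc n)) (step₂ (+ n))))
    where
    s = ∑[ a < n ] (1ℤ + ι a)
    step₁ : ∀ n s → + 2 * (1ℤ + (n * 1ℤ + s)) ≡ + 2 * (1ℤ + n) + + 2 * s
    step₁ = solve-∀
    step₂ : ∀ n → + 2 * (1ℤ + n) + n * (n + 1ℤ) ≡ (1ℤ + n) * ((1ℤ + n) + 1ℤ)
    step₂ = solve-∀

  -- With k points to the left and j to the right, the distances are 1, ..., k and 1, ..., j: two
  -- triangular numbers. Writing the length as `suc (k + j)` keeps the two sides symmetric and free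
  -- of subtraction.
  2*distances : ∀ k j → + 2 * distances (suc (k ℕ.+ j)) (+ k) ≡ + k * (+ k + 1ℤ) + + j * (+ j + 1ℤ)
  2*distances zero    j = trans
    (cong (_*_ (+ 2)) (+-identityˡ _)) (trans (∑-suc j) (sym (+-identityˡ _)))
  2*distances (suc k) j = trans
    (cong (_*_ (+ 2)) (cong₂ _+_ (cong (λ i → + ∣ i ∣) (+-identityʳ (+ suc k)))
      (sum-cong-≗ {suc (k ℕ.+ j)} λ a → cong (λ i → + ∣ i ∣) (shift (+ k) (ι a)))))
    (trans (*-distribˡ-+ (+ 2) (+ suc k) s)
    (trans (cong (_+_ (+ 2 * + suc k)) (2*distances k j)) (step (+ k) (+ j))))
    where
    s = distances (suc (k ℕ.+ j)) (+ k)
    shift : ∀ i j → (1ℤ + i) - (1ℤ + j) ≡ i - j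
    shift = solve-∀
    step : ∀ k j → + 2 * (1ℤ + k) + (k * (k + 1ℤ) + j * (j + 1ℤ)) ≡ (1ℤ + k) * ((1ℤ + k) + 1ℤ) + j * (j + 1ℤ)
    step = solve-∀

  2*distances≤n² : ∀ {n} k → k ℕ.< n → + 2 * distances n (+ k) ≤ + n * + n
  2*distances≤n² {n} k k<n with ℕ.m≤n⇒∃[o]m+o≡n k<n
  ... | j , refl = ≤-trans (≤-reflexive (2*distances k j))
    (≤-by (+-nonNeg (+-nonNeg (*-nonNeg {+ 2 * + k} (*-nonNeg {+ 2} {+ k} 0≤+ 0≤+) (0≤+ {j})) (0≤+ {k})) (+-nonNeg (0≤+ {j}) (0≤+ {1})))
           (identity (+ k) (+ j)))
    where
    identity : ∀ k j → (1ℤ + (k + j)) * (1ℤ + (k + j)) - (k * (k + 1ℤ) + j * (j + 1ℤ)) ≡ + 2 * k * j + k + (j + 1ℤ)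
    identity = solve-∀

  -- (k + j)² + (k - j)² = 2 (k² + j²) with n = 1 + k + j
  n²-2n≤4*distances : ∀ {n} k → k ℕ.< n → + n * + n - + 2 * + n ≤ + 4 * distances n (+ k)
  n²-2n≤4*distances {n} k k<n with ℕ.m≤n⇒∃[o]m+o≡n k<n
  ... | j , refl = ≤-trans
    (≤-by (+-nonNeg (+-nonNeg (square (+ k - + j)) (*-nonNeg {+ 2} 0≤+ (0≤+ {k ℕ.+ j}))) (0≤+ {1})) (identity (+ k) (+ j)))
    (≤-reflexive (trans (cong (_*_ (+ 2)) (sym (2*distances k j))) (sym (*-assoc (+ 2) (+ 2) (distances n (+ k))))))
    where
    square : ∀ i → 0ℤ ≤ i * i
    square (+ i)    = *-nonNeg (0≤+ {i}) 0≤+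
    square -[1+ i ] = 0≤+
    identity : ∀ k j → + 2 * (k * (k + 1ℤ) + j * (j + 1ℤ)) - ((1ℤ + (k + j)) * (1ℤ + (k + j)) - + 2 * (1ℤ + (k + j)))
                     ≡ (k - j) * (k - j) + + 2 * (k + j) + 1ℤ
    identity = solve-∀

  -- The bound n - |t| for a diagonal fails once |t| exceeds n. Moving `w` to the nearest point of
  -- the row 0, ..., n - 1 shortens all distances to the row and brings them within that range.
  clamp : ∀ {n} w → 0 ℕ.< n → ∃[ k ] k ℕ.< n × (∀ (a : Fin n) → ∣ + k - ι a ∣ ℕ.≤ ∣ w - ι a ∣)
  clamp w@(-[1+ p ]) 0<n = 0 , 0<n , λ a → drop‿+≤+ (∣i∣≤
      (≤-trans (≤-by (0≤+ {toℕ a}) (below (ι a))) 0≤+)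
      (≤-trans (≤-by (0≤+ {suc p}) (above w (ι a))) (-i≤+∣i∣ (w - ι a))))
    where
    below : ∀ a → 0ℤ - (0ℤ - a) ≡ a
    below = solve-∀
    above : ∀ w a → - (w - a) - - (0ℤ - a) ≡ - w
    above = solve-∀
  clamp {suc m} (+ p) _ with p ℕ.<? suc m
  ... | yes p<n = p , p<n , λ a → ℕ.≤-refl
  ... | no  p≮n = m , ℕ.≤-refl , λ a → drop‿+≤+ (∣i∣≤
      (≤-trans (+-monoˡ-≤ (- ι a) (+≤+ (ℕ.≤-trans (ℕ.n≤1+n m) (ℕ.≮⇒≥ p≮n)))) (i≤+∣i∣ (+ p - ι a)))
      (≤-trans (≤-by (i≤j⇒0≤j-i (+≤+ (ℕ.<⇒≤pred (Fin.toℕ<n a)))) (above (+ m) (ι a))) 0≤+))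
    where
    above : ∀ m a → 0ℤ - - (m - a) ≡ m - a
    above = solve-∀

  distance≤n : ∀ {n x} → x ℕ.< n → (a : Fin n) → + ∣ + x - ι a ∣ ≤ + n
  distance≤n {n} {x} x<n a = ∣i∣≤ {+ x - ι a}
      (≤-by (+-nonNeg (i≤j⇒0≤j-i (+≤+ (ℕ.<⇒≤ x<n))) (0≤+ {toℕ a})) (right (+ n) (+ x) (ι a)))
      (≤-by (+-nonNeg (i≤j⇒0≤j-i (+≤+ (ℕ.<⇒≤ (Fin.toℕ<n a)))) (0≤+ {x})) (left (+ n) (+ x) (ι a)))
    where
    right : ∀ n k a → n - (k - a) ≡ (n - k) + a
    right = solve-∀
    left : ∀ n k a → n - - (k - a) ≡ (n - a) + k
    left = solve-∀

  -- After clamping, the diagonal at `a` has at most n - |k - a| points, and the distances sum to at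
  -- least (n² - 2n) / 4; this leaves at most n² - (n² - 2n) / 4.
  plane-≤ : ∀ n w → + 4 * ∑[ a < n ] diag n (w - ι a) ≤ + 3 * (+ n * + n) + + 2 * + n
  plane-≤ zero        w = ≤-refl
  plane-≤ n@(suc n-1) w = ≤-by
      (+-nonNeg (*-nonNeg {+ 4} 0≤+ (i≤j⇒0≤j-i total)) (i≤j⇒0≤j-i (n²-2n≤4*distances k k<n)))
      (identity (+ n) (∑[ a < n ] diag n (w - ι a)) (distances n (+ k)))
    where
    k = proj₁ (clamp {n} w (ℕ.s≤s ℕ.z≤n))
    k<n = proj₁ (proj₂ (clamp {n} w (ℕ.s≤s ℕ.z≤n)))
    closer = proj₂ (proj₂ (clamp {n} w (ℕ.s≤s ℕ.z≤n)))
    total : ∑[ a < n ] diag n (w - ι a) + distances n (+ k) ≤ + n * + n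
    total = ≤-trans (≤-reflexive (sym (∑-distrib-+ {n} (λ a → diag n (w - ι a)) (λ a → + ∣ + k - ι a ∣)))) (≤-trans
      (∑-mono {n} {λ a → diag n (w - ι a) + + ∣ + k - ι a ∣} {λ _ → + n} λ a → ≤-by (i≤j⇒0≤j-i (diag≤ {t = w - ι a} (closer a) (drop‿+≤+ (distance≤n k<n a))))
        (shuffle (+ n) (diag n (w - ι a)) (+ ∣ + k - ι a ∣)))
      (≤-reflexive (∑-const n (+ n))))
      where
      shuffle : ∀ n t d → n - (t + d) ≡ (n - d) - t
      shuffle = solve-∀
    identity : ∀ n s d → + 3 * (n * n) + + 2 * n - + 4 * s ≡
                         + 4 * (n * n - (s + d)) + (+ 4 * d - (n * n - + 2 * n))
    identity = solve-∀

  -- Pairs of diagonals, and the total size of the four planes from below.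

  diag-neg : ∀ n t → diag n (- t) ≡ diag n t
  diag-neg n t = cong (λ k → + (n ℕ.∸ k)) (∣-i∣≡∣i∣ t)

  n-t≤diag : ∀ n {t} → 0ℤ ≤ t → + n - t ≤ diag n t
  n-t≤diag n {t} 0≤t = ≤-trans (≤-reflexive (cong (λ i → + n - i) (sym (0≤i⇒+∣i∣≡i 0≤t)))) (n-∣t∣≤diag n t)

  n+t≤diag : ∀ n {t} → t ≤ 0ℤ → + n + t ≤ diag n t
  n+t≤diag n {t} t≤0 = ≤-trans (≤-reflexive (cong (_+_ (+ n)) (sym (neg-involutive t))))
    (≤-trans (n-t≤diag n (neg-mono-≤ t≤0)) (≤-reflexive (diag-neg n t)))

  diagPair : ℕ → ℤ → ℤ → ℤ
  diagPair n α v = diag n (α + v) + diag n (α - v)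

  diagPair-∣v∣ : ∀ n α v → diagPair n α v ≡ diagPair n α (+ ∣ v ∣)
  diagPair-∣v∣ n α (+ q)    = refl
  diagPair-∣v∣ n α -[1+ q ] = +-comm (diag n (α + -[1+ q ])) (diag n (α - -[1+ q ]))

  -- Changing the sign of `v` swaps the two diagonals; changing that of `α` negates both, up to a
  -- swap, and `diag` is even. The case analysis below can thus assume both arguments nonnegative.
  diagPair-∣∣ : ∀ n α v → diagPair n α v ≡ diagPair n (+ ∣ α ∣) (+ ∣ v ∣)
  diagPair-∣∣ n (+ p)    v = diagPair-∣v∣ n (+ p) v
  diagPair-∣∣ n -[1+ p ] v = trans
    (cong₂ _+_ (trans (cong (diag n) (flip₁ (+ suc p) v)) (diag-neg n (+ suc p - v)))
               (trans (cong (diag n) (flip₂ (+ suc p) v)) (diag-neg n (+ suc p + v))))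
    (trans (+-comm (diag n (+ suc p - v)) (diag n (+ suc p + v))) (diagPair-∣v∣ n (+ suc p) v))
    where
    flip₁ : ∀ p v → - p + v ≡ - (p - v)
    flip₁ = solve-∀
    flip₂ : ∀ p v → - p - v ≡ - (p + v)
    flip₂ = solve-∀

  module _ (n : ℕ) {α u : ℤ} (0≤α : 0ℤ ≤ α) (0≤u : 0ℤ ≤ u) where
    private
      n-[α+u]≤ : + n - (α + u) ≤ diag n (α + u)
      n-[α+u]≤ = n-t≤diag n (+-nonNeg 0≤α 0≤u)

    -- Both diagonals are estimated by n - |t|, and the smaller of `α` and `u` cancels.
    2n-2α≤diagPair : u ≤ α → + 2 * + n - + 2 * α ≤ diagPair n α u
    2n-2α≤diagPair u≤α = ≤-trans (≤-reflexive (identity (+ n) α u))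
        (+-mono-≤ n-[α+u]≤ (n-t≤diag n (i≤j⇒0≤j-i u≤α)))
      where
      identity : ∀ n α u → + 2 * n - + 2 * α ≡ (n - (α + u)) + (n - (α - u))
      identity = solve-∀

    2n-2u≤diagPair : α ≤ u → + 2 * + n - + 2 * u ≤ diagPair n α u
    2n-2u≤diagPair α≤u = ≤-trans (≤-reflexive (identity (+ n) α u))
        (+-mono-≤ n-[α+u]≤ (n+t≤diag n (i≤j⇒i-j≤0 α≤u)))
      where
      identity : ∀ n α u → + 2 * n - + 2 * u ≡ (n - (α + u)) + (n + (α - u))
      identity = solve-∀

    -- The far diagonal `α + u` is estimated by 0, which is the better choice once α + u exceeds n
    -- and n - |t| turns negative.
    n-α+u≤diagPair : u ≤ α → + n - α + u ≤ diagPair n α u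
    n-α+u≤diagPair u≤α = ≤-trans (≤-reflexive (identity (+ n) α u))
        (+-mono-≤ 0≤+ (n-t≤diag n (i≤j⇒0≤j-i u≤α)))
      where
      identity : ∀ n α u → n - α + u ≡ 0ℤ + (n - (α - u))
      identity = solve-∀

    n-u+α≤diagPair : α ≤ u → + n - u + α ≤ diagPair n α u
    n-u+α≤diagPair α≤u = ≤-trans (≤-reflexive (identity (+ n) α u))
        (+-mono-≤ 0≤+ (n+t≤diag n (i≤j⇒i-j≤0 α≤u)))
      where
      identity : ∀ n α u → n - u + α ≡ 0ℤ + (n + (α - u))
      identity = solve-∀

  -- Whatever s is, the lower bound is a line in u of nonpositive slope through
  -- u = n / 2 at height 3n / 2 (times n). The distances u = ∣ x - a ∣ average at
  -- most n / 2, so the bounds average at least 3n / 2 and s may depend on α and β.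
  diagPairs-≥-line : ∀ n {α β} → 0ℤ ≤ α → 0ℤ ≤ β → α + β ≤ + n →
    ∃[ s ] s ≤ + n × (∀ {u} → 0ℤ ≤ u → u ≤ + n →
      + n * (+ 3 * + n - s) + (+ 2 * s - + 3 * + n) * u ≤ + n * (diagPair n α u + diagPair n β u))
  diagPairs-≥-line n {α} {β} 0≤α 0≤β α+β≤n with ≤-total (+ 2 * (α + β)) (+ n)
  -- The pairs guarantee height α + β at u = n, rising by at least 2 per step to the left. When 2 (α
  -- + β) < n, the line through that point and (n / 2, 3n / 2) rises faster and may overtake them,
  -- so its end at u = n is lowered to 0.
  ... | inj₁ 2σ≤n = 0ℤ , 0≤+ , λ {u} 0≤u u≤n → ≤-trans (≤-reflexive (factor (+ n) u))
                      (*-monoˡ-≤-nonNeg (+ n) (bound 0≤u))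
    where
    factor : ∀ n u → n * (+ 3 * n - 0ℤ) + (+ 2 * 0ℤ - + 3 * n) * u ≡ n * (+ 3 * n - + 3 * u)
    factor = solve-∀
    0≤n-2σ = i≤j⇒0≤j-i 2σ≤n
    bound : ∀ {u} → 0ℤ ≤ u → + 3 * + n - + 3 * u ≤ diagPair n α u + diagPair n β u
    bound {u} 0≤u with ≤-total α u | ≤-total β u
    ... | inj₁ α≤u | inj₁ β≤u = ≤-trans (≤-by 0≤β (eq (+ n) u β))
        (+-mono-≤ (2n-2u≤diagPair n 0≤α 0≤u α≤u) (n-u+α≤diagPair n 0≤β 0≤u β≤u))
      where
      eq : ∀ n u β → ((+ 2 * n - + 2 * u) + (n - u + β)) - (+ 3 * n - + 3 * u) ≡ β
      eq = solve-∀
    ... | inj₁ α≤u | inj₂ u≤β = ≤-trans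
        (≤-by (+-nonNeg (+-nonNeg 0≤n-2σ (*-nonNeg {+ 2} 0≤+ 0≤α)) 0≤u) (eq (+ n) α β u))
        (+-mono-≤ (2n-2u≤diagPair n 0≤α 0≤u α≤u) (2n-2α≤diagPair n 0≤β 0≤u u≤β))
      where
      eq : ∀ n α β u → ((+ 2 * n - + 2 * u) + (+ 2 * n - + 2 * β)) - (+ 3 * n - + 3 * u) ≡ (n - + 2 * (α + β)) + + 2 * α + u
      eq = solve-∀
    ... | inj₂ u≤α | inj₁ β≤u = ≤-trans
        (≤-by (+-nonNeg (+-nonNeg 0≤n-2σ (*-nonNeg {+ 2} 0≤+ 0≤β)) 0≤u) (eq (+ n) α β u))
        (+-mono-≤ (2n-2α≤diagPair n 0≤α 0≤u u≤α) (2n-2u≤diagPair n 0≤β 0≤u β≤u))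
      where
      eq : ∀ n α β u → ((+ 2 * n - + 2 * α) + (+ 2 * n - + 2 * u)) - (+ 3 * n - + 3 * u) ≡ (n - + 2 * (α + β)) + + 2 * β + u
      eq = solve-∀
    ... | inj₂ u≤α | inj₂ u≤β = ≤-trans
        (≤-by (+-nonNeg 0≤n-2σ (*-nonNeg {+ 3} 0≤+ 0≤u)) (eq (+ n) α β u))
        (+-mono-≤ (2n-2α≤diagPair n 0≤α 0≤u u≤α) (2n-2α≤diagPair n 0≤β 0≤u u≤β))
      where
      eq : ∀ n α β u → ((+ 2 * n - + 2 * α) + (+ 2 * n - + 2 * β)) - (+ 3 * n - + 3 * u) ≡ (n - + 2 * (α + β)) + + 3 * u
      eq = solve-∀
  -- Here the line may end at height α + β for u = n, which is exactly what the two pairs amount to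
  -- there.
  ... | inj₂ n≤2σ = α + β , α+β≤n , λ {u} 0≤u u≤n → bound 0≤u u≤n
    where
    0≤2σ-n = i≤j⇒0≤j-i n≤2σ
    0≤n-σ = i≤j⇒0≤j-i α+β≤n
    line : ℤ → ℤ
    line u = + n * (+ 3 * + n - (α + β)) + (+ 2 * (α + β) - + 3 * + n) * u
    scale : ∀ {u h} → h ≤ diagPair n α u + diagPair n β u → + n * h ≤ + n * (diagPair n α u + diagPair n β u)
    scale = *-monoˡ-≤-nonNeg (+ n)
    bound : ∀ {u} → 0ℤ ≤ u → u ≤ + n → line u ≤ + n * (diagPair n α u + diagPair n β u)
    bound {u} 0≤u u≤n with ≤-total α u | ≤-total β u
    ... | inj₁ α≤u | inj₁ β≤u = ≤-trans
        (≤-by (*-nonNeg (i≤j⇒0≤j-i u≤n) 0≤2σ-n) (eq (+ n) α β u))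
        (scale (+-mono-≤ (n-u+α≤diagPair n 0≤α 0≤u α≤u) (n-u+α≤diagPair n 0≤β 0≤u β≤u)))
      where
      eq : ∀ n α β u → n * ((n - u + α) + (n - u + β)) - (n * (+ 3 * n - (α + β)) + (+ 2 * (α + β) - + 3 * n) * u)
                     ≡ (n - u) * (+ 2 * (α + β) - n)
      eq = solve-∀
    ... | inj₁ α≤u | inj₂ u≤β = ≤-trans
        (≤-by (+-nonNeg (*-nonNeg (0≤+ {n}) 0≤α) (*-nonNeg {+ 2 * u} (*-nonNeg {+ 2} 0≤+ 0≤u) 0≤n-σ)) (eq (+ n) α β u))
        (scale (+-mono-≤ (2n-2u≤diagPair n 0≤α 0≤u α≤u) (n-α+u≤diagPair n 0≤β 0≤u u≤β)))
      where
      eq : ∀ n α β u → n * ((+ 2 * n - + 2 * u) + (n - β + u)) - (n * (+ 3 * n - (α + β)) + (+ 2 * (α + β) - + 3 * n) * u)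
                     ≡ n * α + + 2 * u * (n - (α + β))
      eq = solve-∀
    ... | inj₂ u≤α | inj₁ β≤u = ≤-trans
        (≤-by (+-nonNeg (*-nonNeg (0≤+ {n}) 0≤β) (*-nonNeg {+ 2 * u} (*-nonNeg {+ 2} 0≤+ 0≤u) 0≤n-σ)) (eq (+ n) α β u))
        (scale (+-mono-≤ (n-α+u≤diagPair n 0≤α 0≤u u≤α) (2n-2u≤diagPair n 0≤β 0≤u β≤u)))
      where
      eq : ∀ n α β u → n * ((n - α + u) + (+ 2 * n - + 2 * u)) - (n * (+ 3 * n - (α + β)) + (+ 2 * (α + β) - + 3 * n) * u)
                     ≡ n * β + + 2 * u * (n - (α + β))
      eq = solve-∀
    ... | inj₂ u≤α | inj₂ u≤β = ≤-trans
        (≤-by (+-nonNeg (*-nonNeg (0≤+ {n}) 0≤n-σ)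
                (*-nonNeg (+-nonNeg (0≤+ {n}) (*-nonNeg {+ 2} 0≤+ 0≤n-σ)) 0≤u)) (eq (+ n) α β u))
        (scale (+-mono-≤ (2n-2α≤diagPair n 0≤α 0≤u u≤α) (2n-2α≤diagPair n 0≤β 0≤u u≤β)))
      where
      eq : ∀ n α β u → n * ((+ 2 * n - + 2 * α) + (+ 2 * n - + 2 * β)) - (n * (+ 3 * n - (α + β)) + (+ 2 * (α + β) - + 3 * n) * u)
                     ≡ n * (n - (α + β)) + (n + + 2 * (n - (α + β))) * u
      eq = solve-∀

  -- The slope 2s - 3n is at most 0, so the upper bound n² / 2 for the sum of the distances bounds
  -- the sum of the lines from below, and `s` drops out. The lines carry a factor `n` to stay among
  -- the integers; it is cancelled at the end.
  diagPairs-≥ : ∀ {n} x α β → x ℕ.< n → + ∣ α ∣ + + ∣ β ∣ ≤ + n →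
    + 3 * (+ n * + n) ≤ + 2 * ∑[ a < n ] (diagPair n α (+ x - ι a) + diagPair n β (+ x - ι a))
  diagPairs-≥ {n} x α β x<n α+β≤n = *-cancelˡ-≤-pos _ _ (+ n) {{positive (+<+ (ℕ.≤-<-trans ℕ.z≤n x<n))}}
    (≤-by (+-nonNeg (*-nonNeg {+ 2} 0≤+ (i≤j⇒0≤j-i total))
            (*-nonNeg (+-nonNeg (0≤+ {n}) (*-nonNeg {+ 2} 0≤+ (i≤j⇒0≤j-i s≤n))) (i≤j⇒0≤j-i (2*distances≤n² x x<n))))
      (identity (+ n) s (distances n (+ x)) (sum H)))
    where
    H : Fin n → ℤ
    H a = diagPair n α (+ x - ι a) + diagPair n β (+ x - ι a)
    s = proj₁ (diagPairs-≥-line n {+ ∣ α ∣} {+ ∣ β ∣} 0≤+ 0≤+ α+β≤n)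
    s≤n = proj₁ (proj₂ (diagPairs-≥-line n {+ ∣ α ∣} {+ ∣ β ∣} 0≤+ 0≤+ α+β≤n))
    c = + n * (+ 3 * + n - s)
    d = + 2 * s - + 3 * + n
    pointwise : ∀ a → c + d * + ∣ + x - ι a ∣ ≤ + n * H a
    pointwise a = ≤-trans
      (proj₂ (proj₂ (diagPairs-≥-line n {+ ∣ α ∣} {+ ∣ β ∣} 0≤+ 0≤+ α+β≤n)) 0≤+ (distance≤n x<n a))
      (≤-reflexive (cong (_*_ (+ n)) (sym (cong₂ _+_ (diagPair-∣∣ n α (+ x - ι a)) (diagPair-∣∣ n β (+ x - ι a))))))
    total : + n * c + d * distances n (+ x) ≤ + n * sum H
    total = ≤-trans
      (≤-reflexive (trans (cong₂ _+_ (sym (∑-const n c)) (*-distribˡ-sum {n} d (λ a → + ∣ + x - ι a ∣)))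
        (sym (∑-distrib-+ {n} (λ _ → c) (λ a → d * + ∣ + x - ι a ∣)))))
      (≤-trans (∑-mono {n} pointwise) (≤-reflexive (sym (*-distribˡ-sum {n} (+ n) H))))
    identity : ∀ n s D h → n * (+ 2 * h) - n * (+ 3 * (n * n)) ≡
      + 2 * (n * h - (n * (n * (+ 3 * n - s)) + (+ 2 * s - + 3 * n) * D)) + (n + + 2 * (n - s)) * (n * n - + 2 * D)
    identity = solve-∀

  -- Inclusion and exclusion for four planes, and their pairwise intersections.

  ≤-dec : ∀ {i j} {i≤j : True (i ≤? j)} → i ≤ j
  ≤-dec {i≤j = i≤j} = toWitness i≤j

  module _ {P Q R S : Set} where

    -- The union bound. The grouping of `p` with `s` and of `q` with `r` anticipates the planes that
    -- form a pair of diagonals.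
    𝟙-union≤ : (p : Dec P) (q : Dec Q) (r : Dec R) (s : Dec S) →
      𝟙 (p ⊎-dec q ⊎-dec r ⊎-dec s) ≤ 𝟙 p + 𝟙 s + (𝟙 q + 𝟙 r)
    𝟙-union≤ (yes _) (yes _) (yes _) (yes _) = ≤-dec
    𝟙-union≤ (yes _) (yes _) (yes _) (no  _) = ≤-dec
    𝟙-union≤ (yes _) (yes _) (no  _) (yes _) = ≤-dec
    𝟙-union≤ (yes _) (yes _) (no  _) (no  _) = ≤-dec
    𝟙-union≤ (yes _) (no  _) (yes _) (yes _) = ≤-dec
    𝟙-union≤ (yes _) (no  _) (yes _) (no  _) = ≤-dec
    𝟙-union≤ (yes _) (no  _) (no  _) (yes _) = ≤-dec
    𝟙-union≤ (yes _) (no  _) (no  _) (no  _) = ≤-dec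
    𝟙-union≤ (no  _) (yes _) (yes _) (yes _) = ≤-dec
    𝟙-union≤ (no  _) (yes _) (yes _) (no  _) = ≤-dec
    𝟙-union≤ (no  _) (yes _) (no  _) (yes _) = ≤-dec
    𝟙-union≤ (no  _) (yes _) (no  _) (no  _) = ≤-dec
    𝟙-union≤ (no  _) (no  _) (yes _) (yes _) = ≤-dec
    𝟙-union≤ (no  _) (no  _) (yes _) (no  _) = ≤-dec
    𝟙-union≤ (no  _) (no  _) (no  _) (yes _) = ≤-dec
    𝟙-union≤ (no  _) (no  _) (no  _) (no  _) = ≤-dec

    pairs : (p : Dec P) (q : Dec Q) (r : Dec R) (s : Dec S) → ℤ
    pairs p q r s = (𝟙 (p ×-dec q) + 𝟙 (p ×-dec r)) + (𝟙 (q ×-dec s) + 𝟙 (r ×-dec s)) +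
                    (𝟙 (p ×-dec s) + 𝟙 (q ×-dec r))

    -- Bonferroni: a space on j ≥ 1 of the planes is counted j times on the left and 1 + j (j - 1) /
    -- 2 times on the right.
    ≤𝟙-union+pairs : (p : Dec P) (q : Dec Q) (r : Dec R) (s : Dec S) →
      𝟙 p + 𝟙 s + (𝟙 q + 𝟙 r) ≤ 𝟙 (p ⊎-dec q ⊎-dec r ⊎-dec s) + pairs p q r s
    ≤𝟙-union+pairs (yes _) (yes _) (yes _) (yes _) = ≤-dec
    ≤𝟙-union+pairs (yes _) (yes _) (yes _) (no  _) = ≤-dec
    ≤𝟙-union+pairs (yes _) (yes _) (no  _) (yes _) = ≤-dec
    ≤𝟙-union+pairs (yes _) (yes _) (no  _) (no  _) = ≤-dec
    ≤𝟙-union+pairs (yes _) (no  _) (yes _) (yes _) = ≤-dec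
    ≤𝟙-union+pairs (yes _) (no  _) (yes _) (no  _) = ≤-dec
    ≤𝟙-union+pairs (yes _) (no  _) (no  _) (yes _) = ≤-dec
    ≤𝟙-union+pairs (yes _) (no  _) (no  _) (no  _) = ≤-dec
    ≤𝟙-union+pairs (no  _) (yes _) (yes _) (yes _) = ≤-dec
    ≤𝟙-union+pairs (no  _) (yes _) (yes _) (no  _) = ≤-dec
    ≤𝟙-union+pairs (no  _) (yes _) (no  _) (yes _) = ≤-dec
    ≤𝟙-union+pairs (no  _) (yes _) (no  _) (no  _) = ≤-dec
    ≤𝟙-union+pairs (no  _) (no  _) (yes _) (yes _) = ≤-dec
    ≤𝟙-union+pairs (no  _) (no  _) (yes _) (no  _) = ≤-dec
    ≤𝟙-union+pairs (no  _) (no  _) (no  _) (yes _) = ≤-dec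
    ≤𝟙-union+pairs (no  _) (no  _) (no  _) (no  _) = ≤-dec

  ∑³ : (Fin n → Fin n → Fin n → ℤ) → ℤ
  ∑³ {n} f = ∑[ a < n ] ∑[ b < n ] ∑[ c < n ] f a b c

  ∑³-mono : {f g : Fin n → Fin n → Fin n → ℤ} → (∀ a b c → f a b c ≤ g a b c) → ∑³ f ≤ ∑³ g
  ∑³-mono {n} f≤g = ∑-mono {n} λ a → ∑-mono {n} λ b → ∑-mono {n} λ c → f≤g a b c

  ∑³-+ : (f g : Fin n → Fin n → Fin n → ℤ) → ∑³ (λ a b c → f a b c + g a b c) ≡ ∑³ f + ∑³ g
  ∑³-+ {n} f g = trans
    (sum-cong-≗ {n} λ a → trans (sum-cong-≗ {n} λ b → ∑-distrib-+ {n} (f a b) (g a b))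
                                (∑-distrib-+ {n} (λ b → sum (f a b)) (λ b → sum (g a b))))
    (∑-distrib-+ {n} (λ a → ∑[ b < n ] sum (f a b)) (λ a → ∑[ b < n ] sum (g a b)))

  ∑³𝟙-unique₂₃ : {R : Fin n → Fin n → Fin n → Set} (R? : ∀ a b c → Dec (R a b c)) →
    (∀ {a b c b′ c′} → R a b c → R a b′ c′ → b ≡ b′ × c ≡ c′) →
    ∑³ (λ a b c → 𝟙 (R? a b c)) ≤ + n
  ∑³𝟙-unique₂₃ {n} R? uniq = ≤-trans (∑-mono {n} λ a → ∑∑𝟙-unique (R? a) uniq)
    (≤-reflexive (trans (∑-const n 1ℤ) (*-identityʳ (+ n))))

  ∑³𝟙-unique₁₃ : {R : Fin n → Fin n → Fin n → Set} (R? : ∀ a b c → Dec (R a b c)) →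
    (∀ {a b c a′ c′} → R a b c → R a′ b c′ → a ≡ a′ × c ≡ c′) →
    ∑³ (λ a b c → 𝟙 (R? a b c)) ≤ + n
  ∑³𝟙-unique₁₃ {n} R? uniq = ≤-trans
    (≤-reflexive (∑-comm {n} {n} λ a b → ∑[ c < n ] 𝟙 (R? a b c)))
    (∑³𝟙-unique₂₃ (λ b a c → R? a b c) uniq)

  -- Any two of the four equations agree on some of the displacements and, up to an overall sign,
  -- differ by the sign of the rest. This separates the two groups.
  p+q≡0∧p-q≡0 : ∀ p q → p + q ≡ 0ℤ → p - q ≡ 0ℤ → p ≡ 0ℤ × q ≡ 0ℤ
  p+q≡0∧p-q≡0 p q +≡0 -≡0 = half p (trans (sum≡ p q) (cong₂ _+_ +≡0 -≡0)) , half q (trans (diff≡ p q) (cong₂ _-_ +≡0 -≡0))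
    where
    half : ∀ i → + 2 * i ≡ 0ℤ → i ≡ 0ℤ
    half i 2i≡0 = *-cancelˡ-≡ (+ 2) i 0ℤ 2i≡0
    sum≡ : ∀ p q → + 2 * p ≡ (p + q) + (p - q)
    sum≡ = solve-∀
    diff≡ : ∀ p q → + 2 * q ≡ (p + q) - (p - q)
    diff≡ = solve-∀

  i-j≡i-k⇒j≡k : ∀ i {j k} → i - j ≡ i - k → j ≡ k
  i-j≡i-k⇒j≡k i eq = neg-injective (∙-cancelˡ i _ _ eq)

  coord-injective : ∀ {i j : Fin n} → coord i ≡ coord j → i ≡ j
  coord-injective eq = Fin.toℕ-injective (ℕ.suc-injective (+-injective eq))

  𝟙-diff : ∀ {d} i j → d ≡ i - j → 𝟙 (d ≟ 0ℤ) ≡ 𝟙 (i ≟ j)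
  𝟙-diff {d} i j d≡i-j = 𝟙-cong (d ≟ 0ℤ) (i ≟ j)
    (λ d≡0 → i-j≡0⇒i≡j i j (trans (sym d≡i-j) d≡0)) (λ i≡j → trans d≡i-j (i≡j⇒i-j≡0 i≡j))

  𝟙-diff′ : ∀ {d} i j → d ≡ j - i → 𝟙 (d ≟ 0ℤ) ≡ 𝟙 (i ≟ j)
  𝟙-diff′ i j d≡j-i = trans (𝟙-diff j i d≡j-i) (𝟙-cong (j ≟ i) (i ≟ j) sym sym)

  -- The number of spaces attacking a given space.

  attackers : Space n → ℕ
  attackers {n} x = count (λ a → attacks? a x) (spaces n)

  -- For a fixed first coordinate each plane is a diagonal b - c = t, after reflecting
  -- c where the plane fixes b + c. The diagonals come in the pairs ± (x - a) about
  -- α and β, and ∣ α ∣ + ∣ β ∣ = max (∣ 2y - (n - 1) ∣) (∣ 2z - (n - 1) ∣).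
  module _ {n} (x₁ x₂ x₃ : Fin n) where
    private
      x = ι x₁
      y = ι x₂
      z = ι x₃
      α = y + z - (+ n - 1ℤ)
      β = y - z

      d₁ d₂ d₃ : Fin n → ℤ
      d₁ a = coord x₁ - coord a
      d₂ b = coord x₂ - coord b
      d₃ c = coord x₃ - coord c

      p₀ = λ a b c → d₁ a + d₂ b + d₃ c ≟ 0ℤ
      p₁ = λ a b c → d₁ a + d₂ b - d₃ c ≟ 0ℤ
      p₂ = λ a b c → d₁ a - d₂ b + d₃ c ≟ 0ℤ
      p₃ = λ a b c → d₁ a - d₂ b - d₃ c ≟ 0ℤ

      d-injective : ∀ (x : Fin n) {i j : Fin n} → coord x - coord i ≡ coord x - coord j → i ≡ j
      d-injective x eq = coord-injective (i-j≡i-k⇒j≡k (coord x) eq)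

      plane₀ : ∀ a → ∑[ b < n ] ∑[ c < n ] 𝟙 (p₀ a b c) ≡ diag n (α + (x - ι a))
      plane₀ a = trans (sum-cong-≗ {n} λ b → sum-cong-≗ {n} λ c →
          𝟙-diff′ (ι b + ι c) (x - ι a + (y + z)) (eq x (ι a) y (ι b) z (ι c)))
        (trans (∑∑𝟙-sum n (x - ι a + (y + z))) (cong (diag n) (eq′ x (ι a) (y + z) (+ n))))
        where
        eq : ∀ x a y b z c → ((1ℤ + x) - (1ℤ + a)) + ((1ℤ + y) - (1ℤ + b)) + ((1ℤ + z) - (1ℤ + c)) ≡ (x - a + (y + z)) - (b + c)
        eq = solve-∀
        eq′ : ∀ x a s n → (x - a + s) - (n - 1ℤ) ≡ s - (n - 1ℤ) + (x - a)
        eq′ = solve-∀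

      plane₁ : ∀ a → ∑[ b < n ] ∑[ c < n ] 𝟙 (p₁ a b c) ≡ diag n (β + (x - ι a))
      plane₁ a = trans (sum-cong-≗ {n} λ b → sum-cong-≗ {n} λ c →
          𝟙-diff′ (ι b - ι c) (β + (x - ι a)) (eq x (ι a) y (ι b) z (ι c)))
        (∑∑𝟙-difference n (β + (x - ι a)))
        where
        eq : ∀ x a y b z c → ((1ℤ + x) - (1ℤ + a)) + ((1ℤ + y) - (1ℤ + b)) - ((1ℤ + z) - (1ℤ + c)) ≡ (y - z + (x - a)) - (b - c)
        eq = solve-∀

      plane₂ : ∀ a → ∑[ b < n ] ∑[ c < n ] 𝟙 (p₂ a b c) ≡ diag n (β - (x - ι a))
      plane₂ a = trans (sum-cong-≗ {n} λ b → sum-cong-≗ {n} λ c →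
          𝟙-diff (ι b - ι c) (β - (x - ι a)) (eq x (ι a) y (ι b) z (ι c)))
        (∑∑𝟙-difference n (β - (x - ι a)))
        where
        eq : ∀ x a y b z c → ((1ℤ + x) - (1ℤ + a)) - ((1ℤ + y) - (1ℤ + b)) + ((1ℤ + z) - (1ℤ + c)) ≡ (b - c) - (y - z - (x - a))
        eq = solve-∀

      plane₃ : ∀ a → ∑[ b < n ] ∑[ c < n ] 𝟙 (p₃ a b c) ≡ diag n (α - (x - ι a))
      plane₃ a = trans (sum-cong-≗ {n} λ b → sum-cong-≗ {n} λ c →
          𝟙-diff (ι b + ι c) (y + z - (x - ι a)) (eq x (ι a) y (ι b) z (ι c)))
        (trans (∑∑𝟙-sum n (y + z - (x - ι a))) (cong (diag n) (eq′ x (ι a) (y + z) (+ n))))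
        where
        eq : ∀ x a y b z c → ((1ℤ + x) - (1ℤ + a)) - ((1ℤ + y) - (1ℤ + b)) - ((1ℤ + z) - (1ℤ + c)) ≡ (b + c) - (y + z - (x - a))
        eq = solve-∀
        eq′ : ∀ x a s n → (s - (x - a)) - (n - 1ℤ) ≡ s - (n - 1ℤ) - (x - a)
        eq′ = solve-∀

      planes : ℤ
      planes = ∑³ λ a b c → 𝟙 (p₀ a b c) + 𝟙 (p₃ a b c) + (𝟙 (p₁ a b c) + 𝟙 (p₂ a b c))

      planes≡ : planes ≡ ∑[ a < n ] (diagPair n α (x - ι a) + diagPair n β (x - ι a))
      planes≡ = trans (∑³-+ (λ a b c → 𝟙 (p₀ a b c) + 𝟙 (p₃ a b c)) (λ a b c → 𝟙 (p₁ a b c) + 𝟙 (p₂ a b c)))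
        (trans (cong₂ _+_
          (trans (∑³-+ (λ a b c → 𝟙 (p₀ a b c)) (λ a b c → 𝟙 (p₃ a b c)))
            (trans (cong₂ _+_ (sum-cong-≗ {n} plane₀) (sum-cong-≗ {n} plane₃))
              (sym (∑-distrib-+ {n} (λ a → diag n (α + (x - ι a))) (λ a → diag n (α - (x - ι a)))))))
          (trans (∑³-+ (λ a b c → 𝟙 (p₁ a b c)) (λ a b c → 𝟙 (p₂ a b c)))
            (trans (cong₂ _+_ (sum-cong-≗ {n} plane₁) (sum-cong-≗ {n} plane₂))
              (sym (∑-distrib-+ {n} (λ a → diag n (β + (x - ι a))) (λ a → diag n (β - (x - ι a))))))))
        (sym (∑-distrib-+ {n} (λ a → diagPair n α (x - ι a)) (λ a → diagPair n β (x - ι a)))))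

      -- Both diagonals of a pair take the form `w - ι a` with w = x + γ or w = x - γ, the second
      -- after a change of sign, so each is a single plane for `plane-≤`.
      4*diagPairs≤ : ∀ γ → + 4 * ∑[ a < n ] diagPair n γ (x - ι a) ≤ + 6 * (+ n * + n) + + 4 * + n
      4*diagPairs≤ γ = ≤-trans
        (≤-reflexive (trans (cong (_*_ (+ 4)) (trans (∑-distrib-+ {n} (λ a → diag n (γ + (x - ι a))) (λ a → diag n (γ - (x - ι a)))) (cong₂ _+_
            (sum-cong-≗ {n} λ a → cong (diag n) (eq₁ γ x (ι a)))
            (sum-cong-≗ {n} λ a → trans (cong (diag n) (eq₂ γ x (ι a))) (diag-neg n (x - γ - ι a))))))
          (*-distribˡ-+ (+ 4) (∑[ a < n ] diag n (x + γ - ι a)) (∑[ a < n ] diag n (x - γ - ι a)))))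
        (≤-trans (+-mono-≤ (plane-≤ n (x + γ)) (plane-≤ n (x - γ))) (≤-reflexive (double (+ n))))
        where
        eq₁ : ∀ γ x a → γ + (x - a) ≡ x + γ - a
        eq₁ = solve-∀
        eq₂ : ∀ γ x a → γ - (x - a) ≡ - (x - γ - a)
        eq₂ = solve-∀
        double : ∀ n → (+ 3 * (n * n) + + 2 * n) + (+ 3 * (n * n) + + 2 * n) ≡ + 6 * (n * n) + + 4 * n
        double = solve-∀

    attackers-≤ : + attackers (x₁ , x₂ , x₃) ≤ + 3 * (+ n * + n) + + 2 * + n
    attackers-≤ = ≤-trans
      (≤-trans (≤-reflexive (count-spaces λ a → attacks? a (x₁ , x₂ , x₃)))
        (∑³-mono {n} λ a b c → 𝟙-union≤ (p₀ a b c) (p₁ a b c) (p₂ a b c) (p₃ a b c)))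
      (≤-trans (≤-reflexive planes≡) (*-cancelˡ-≤-pos _ _ (+ 4)
        (≤-trans (≤-reflexive (trans (cong (_*_ (+ 4)) (∑-distrib-+ {n} (pairSum α) (pairSum β))) (*-distribˡ-+ (+ 4) (sum (pairSum α)) (sum (pairSum β)))))
          (≤-trans (+-mono-≤ (4*diagPairs≤ α) (4*diagPairs≤ β)) (≤-reflexive (quarter (+ n)))))))
      where
      pairSum : ℤ → Fin n → ℤ
      pairSum γ a = diagPair n γ (x - ι a)
      quarter : ∀ n → (+ 6 * (n * n) + + 4 * n) + (+ 6 * (n * n) + + 4 * n) ≡ + 4 * (+ 3 * (n * n) + + 2 * n)
      quarter = solve-∀

    private
      room : ∀ (i : Fin n) → 0ℤ ≤ + n - (1ℤ + ι i)
      room i = i≤j⇒0≤j-i (+≤+ (Fin.toℕ<n i))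

      ∣α∣+∣β∣≤n : + ∣ α ∣ + + ∣ β ∣ ≤ + n
      ∣α∣+∣β∣≤n with +∣i∣≡i⊎+∣i∣≡-i α | +∣i∣≡i⊎+∣i∣≡-i β
      ... | inj₁ α+ | inj₁ β+ = ≤-trans (≤-reflexive (cong₂ _+_ α+ β+))
          (≤-by (+-nonNeg (*-nonNeg {+ 2} 0≤+ (room x₂)) 0≤+) (eq (+ n) y z))
        where
        eq : ∀ n y z → n - ((y + z - (n - 1ℤ)) + (y - z)) ≡ + 2 * (n - (1ℤ + y)) + 1ℤ
        eq = solve-∀
      ... | inj₁ α+ | inj₂ β- = ≤-trans (≤-reflexive (cong₂ _+_ α+ β-))
          (≤-by (+-nonNeg (*-nonNeg {+ 2} 0≤+ (room x₃)) 0≤+) (eq (+ n) y z))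
        where
        eq : ∀ n y z → n - ((y + z - (n - 1ℤ)) + - (y - z)) ≡ + 2 * (n - (1ℤ + z)) + 1ℤ
        eq = solve-∀
      ... | inj₂ α- | inj₁ β+ = ≤-trans (≤-reflexive (cong₂ _+_ α- β+))
          (≤-by (+-nonNeg (*-nonNeg {+ 2} {z} 0≤+ 0≤+) 0≤+) (eq (+ n) y z))
        where
        eq : ∀ n y z → n - (- (y + z - (n - 1ℤ)) + (y - z)) ≡ + 2 * z + 1ℤ
        eq = solve-∀
      ... | inj₂ α- | inj₂ β- = ≤-trans (≤-reflexive (cong₂ _+_ α- β-))
          (≤-by (+-nonNeg (*-nonNeg {+ 2} {y} 0≤+ 0≤+) 0≤+) (eq (+ n) y z))
        where
        eq : ∀ n y z → n - (- (y + z - (n - 1ℤ)) + - (y - z)) ≡ + 2 * y + 1ℤ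
        eq = solve-∀

      -- The equations separate into `d₁ a + d₂ b ≡ 0` and `d₃ c ≡ 0`. The intersection is a line on
      -- which `a` determines the other two coordinates.
      meet₀₁ : ∑³ (λ a b c → 𝟙 (p₀ a b c ×-dec p₁ a b c)) ≤ + n
      meet₀₁ = ∑³𝟙-unique₂₃ (λ a b c → p₀ a b c ×-dec p₁ a b c) λ {a} {b} {c} {b′} {c′} (e , f) (e′ , f′) →
        let p , q = p+q≡0∧p-q≡0 (d₁ a + d₂ b) (d₃ c) e f
            p′ , q′ = p+q≡0∧p-q≡0 (d₁ a + d₂ b′) (d₃ c′) e′ f′
        in d-injective x₂ (∙-cancelˡ (d₁ a) _ _ (trans p (sym p′))) , d-injective x₃ (trans q (sym q′))

      meet₂₃ : ∑³ (λ a b c → 𝟙 (p₂ a b c ×-dec p₃ a b c)) ≤ + n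
      meet₂₃ = ∑³𝟙-unique₂₃ (λ a b c → p₂ a b c ×-dec p₃ a b c) λ {a} {b} {c} {b′} {c′} (e , f) (e′ , f′) →
        let p , q = p+q≡0∧p-q≡0 (d₁ a - d₂ b) (d₃ c) e f
            p′ , q′ = p+q≡0∧p-q≡0 (d₁ a - d₂ b′) (d₃ c′) e′ f′
        in d-injective x₂ (i-j≡i-k⇒j≡k (d₁ a) (trans p (sym p′))) , d-injective x₃ (trans q (sym q′))

      meet₀₂ : ∑³ (λ a b c → 𝟙 (p₀ a b c ×-dec p₂ a b c)) ≤ + n
      meet₀₂ = ∑³𝟙-unique₂₃ (λ a b c → p₀ a b c ×-dec p₂ a b c) λ {a} {b} {c} {b′} {c′} (e , f) (e′ , f′) →
        let p , q = split a b c e f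
            p′ , q′ = split a b′ c′ e′ f′
        in d-injective x₂ (trans q (sym q′)) , d-injective x₃ (∙-cancelˡ (d₁ a) _ _ (trans p (sym p′)))
        where
        eq₊ : ∀ p q r → (p + r) + q ≡ p + q + r
        eq₊ = solve-∀
        eq₋ : ∀ p q r → (p + r) - q ≡ p - q + r
        eq₋ = solve-∀
        split : ∀ a b c → d₁ a + d₂ b + d₃ c ≡ 0ℤ → d₁ a - d₂ b + d₃ c ≡ 0ℤ → d₁ a + d₃ c ≡ 0ℤ × d₂ b ≡ 0ℤ
        split a b c e f = p+q≡0∧p-q≡0 (d₁ a + d₃ c) (d₂ b)
          (trans (eq₊ (d₁ a) (d₂ b) (d₃ c)) e) (trans (eq₋ (d₁ a) (d₂ b) (d₃ c)) f)

      meet₁₃ : ∑³ (λ a b c → 𝟙 (p₁ a b c ×-dec p₃ a b c)) ≤ + n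
      meet₁₃ = ∑³𝟙-unique₂₃ (λ a b c → p₁ a b c ×-dec p₃ a b c) λ {a} {b} {c} {b′} {c′} (e , f) (e′ , f′) →
        let p , q = split a b c e f
            p′ , q′ = split a b′ c′ e′ f′
        in d-injective x₂ (trans q (sym q′)) , d-injective x₃ (i-j≡i-k⇒j≡k (d₁ a) (trans p (sym p′)))
        where
        eq₊ : ∀ p q r → (p - r) + q ≡ p + q - r
        eq₊ = solve-∀
        eq₋ : ∀ p q r → (p - r) - q ≡ p - q - r
        eq₋ = solve-∀
        split : ∀ a b c → d₁ a + d₂ b - d₃ c ≡ 0ℤ → d₁ a - d₂ b - d₃ c ≡ 0ℤ → d₁ a - d₃ c ≡ 0ℤ × d₂ b ≡ 0ℤ
        split a b c e f = p+q≡0∧p-q≡0 (d₁ a - d₃ c) (d₂ b)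
          (trans (eq₊ (d₁ a) (d₂ b) (d₃ c)) e) (trans (eq₋ (d₁ a) (d₂ b) (d₃ c)) f)

      -- Here `d₁ a` itself vanishes, so the first coordinate is constant on the line and `b` serves
      -- as its parameter.
      meet₀₃ : ∑³ (λ a b c → 𝟙 (p₀ a b c ×-dec p₃ a b c)) ≤ + n
      meet₀₃ = ∑³𝟙-unique₁₃ (λ a b c → p₀ a b c ×-dec p₃ a b c) λ {a} {b} {c} {a′} {c′} (e , f) (e′ , f′) →
        let p , q = split a b c e f
            p′ , q′ = split a′ b c′ e′ f′
        in d-injective x₁ (trans p (sym p′)) , d-injective x₃ (∙-cancelˡ (d₂ b) _ _ (trans q (sym q′)))
        where
        eq₊ : ∀ p q r → p + (q + r) ≡ p + q + r
        eq₊ = solve-∀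
        eq₋ : ∀ p q r → p - (q + r) ≡ p - q - r
        eq₋ = solve-∀
        split : ∀ a b c → d₁ a + d₂ b + d₃ c ≡ 0ℤ → d₁ a - d₂ b - d₃ c ≡ 0ℤ → d₁ a ≡ 0ℤ × d₂ b + d₃ c ≡ 0ℤ
        split a b c e f = p+q≡0∧p-q≡0 (d₁ a) (d₂ b + d₃ c)
          (trans (eq₊ (d₁ a) (d₂ b) (d₃ c)) e) (trans (eq₋ (d₁ a) (d₂ b) (d₃ c)) f)

      meet₁₂ : ∑³ (λ a b c → 𝟙 (p₁ a b c ×-dec p₂ a b c)) ≤ + n
      meet₁₂ = ∑³𝟙-unique₁₃ (λ a b c → p₁ a b c ×-dec p₂ a b c) λ {a} {b} {c} {a′} {c′} (e , f) (e′ , f′) →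
        let p , q = split a b c e f
            p′ , q′ = split a′ b c′ e′ f′
        in d-injective x₁ (trans p (sym p′)) , d-injective x₃ (i-j≡i-k⇒j≡k (d₂ b) (trans q (sym q′)))
        where
        eq₊ : ∀ p q r → p + (q - r) ≡ p + q - r
        eq₊ = solve-∀
        eq₋ : ∀ p q r → p - (q - r) ≡ p - q + r
        eq₋ = solve-∀
        split : ∀ a b c → d₁ a + d₂ b - d₃ c ≡ 0ℤ → d₁ a - d₂ b + d₃ c ≡ 0ℤ → d₁ a ≡ 0ℤ × d₂ b - d₃ c ≡ 0ℤ
        split a b c e f = p+q≡0∧p-q≡0 (d₁ a) (d₂ b - d₃ c)
          (trans (eq₊ (d₁ a) (d₂ b) (d₃ c)) e) (trans (eq₋ (d₁ a) (d₂ b) (d₃ c)) f)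

      lines≤ : ∑³ (λ a b c → pairs (p₀ a b c) (p₁ a b c) (p₂ a b c) (p₃ a b c)) ≤ + 6 * + n
      lines≤ = ≤-trans (+³ both₁ both₂ both₃) (≤-reflexive (eq (+ n)))
        where
        +² : ∀ {f g : Fin n → Fin n → Fin n → ℤ} {u v} → ∑³ f ≤ u → ∑³ g ≤ v → ∑³ (λ a b c → f a b c + g a b c) ≤ u + v
        +² {f} {g} f≤u g≤v = ≤-trans (≤-reflexive (∑³-+ f g)) (+-mono-≤ f≤u g≤v)
        +³ : ∀ {f g h : Fin n → Fin n → Fin n → ℤ} {u v w} → ∑³ f ≤ u → ∑³ g ≤ v → ∑³ h ≤ w →
             ∑³ (λ a b c → f a b c + g a b c + h a b c) ≤ u + v + w
        +³ {f} {g} {h} f≤u g≤v h≤w = +² {λ a b c → f a b c + g a b c} {h} (+² {f} {g} f≤u g≤v) h≤w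
        both₁ = +² {λ a b c → 𝟙 (p₀ a b c ×-dec p₁ a b c)} {λ a b c → 𝟙 (p₀ a b c ×-dec p₂ a b c)} meet₀₁ meet₀₂
        both₂ = +² {λ a b c → 𝟙 (p₁ a b c ×-dec p₃ a b c)} {λ a b c → 𝟙 (p₂ a b c ×-dec p₃ a b c)} meet₁₃ meet₂₃
        both₃ = +² {λ a b c → 𝟙 (p₀ a b c ×-dec p₃ a b c)} {λ a b c → 𝟙 (p₁ a b c ×-dec p₂ a b c)} meet₀₃ meet₁₂
        eq : ∀ n → (n + n) + (n + n) + (n + n) ≡ + 6 * n
        eq = solve-∀

    -- The planes counted with multiplicity exceed their union by at most the six pairwise
    -- intersections, 6n in all; doubling gives 12n.
    attackers-≥ : + 3 * (+ n * + n) ≤ + 2 * + attackers (x₁ , x₂ , x₃) + + 12 * + n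
    attackers-≥ = ≤-trans
      (diagPairs-≥ (toℕ x₁) α β (Fin.toℕ<n x₁) ∣α∣+∣β∣≤n)
      (≤-trans (*-monoˡ-≤-nonNeg (+ 2) (≤-trans (≤-reflexive (sym planes≡)) (≤-trans
          (∑³-mono {n} λ a b c → ≤𝟙-union+pairs (p₀ a b c) (p₁ a b c) (p₂ a b c) (p₃ a b c))
          (≤-trans (≤-reflexive (∑³-+ (λ a b c → 𝟙 (attacks? (a , b , c) (x₁ , x₂ , x₃))) (λ a b c → pairs (p₀ a b c) (p₁ a b c) (p₂ a b c) (p₃ a b c))))
            (+-mono-≤ (≤-reflexive (sym (count-spaces λ a → attacks? a (x₁ , x₂ , x₃)))) lines≤)))))
        (≤-reflexive (eq (+ attackers (x₁ , x₂ , x₃)) (+ n))))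
      where
      eq : ∀ A n → + 2 * (A + + 6 * n) ≡ + 2 * A + + 12 * n
      eq = solve-∀

-- Safe configurations as binomial coefficients, and ratios of these.

module Configurations where

  open import Data.Nat.Base
  open import Data.Nat.ListAction using (sum)
  open import Data.Nat.Properties
  open import Data.Nat.Tactic.RingSolver using (solve-∀)
  open Counting using (count; count-++; count-map; attackers)

  private variable
    A B : Set

  count-cong : {P Q : Pred A 0ℓ} (P? : Decidable P) (Q? : Decidable Q) →
               (∀ {x} → P x → Q x) → (∀ {x} → Q x → P x) → ∀ xs → count P? xs ≡ count Q? xs
  count-cong P? Q? P⇒Q Q⇒P xs = cong length (List.filter-≐ P? Q? (P⇒Q , Q⇒P) xs)

  count-complement : {P : Pred A 0ℓ} (P? : Decidable P) (xs : List A) →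
                     count (¬? ∘ P?) xs + count P? xs ≡ length xs
  count-complement P? []       = refl
  count-complement P? (x ∷ xs) with P? x
  ... | yes _ = trans (+-suc _ _) (cong suc (count-complement P? xs))
  ... | no  _ = cong suc (count-complement P? xs)

  -- Double counting. Applied to pairs of a configuration and a safe space, it replaces the safe
  -- spaces of each configuration by the configurations that leave each space safe.
  count-comm : {R : A → B → Set} (R? : ∀ a b → Dec (R a b)) (xs : List A) (ys : List B) →
    sum (map (λ a → count (R? a) ys) xs) ≡ sum (map (λ b → count (λ a → R? a b) xs) ys)
  count-comm R? []       ys = sym (zeros ys)
    where
    zeros : (ys : List B) → sum (map (λ _ → 0) ys) ≡ 0
    zeros []       = refl
    zeros (_ ∷ ys) = zeros ys
  count-comm {B = B} R? (x ∷ xs) ys = trans (cong (_+_ (count (R? x) ys)) (count-comm R? xs ys)) (row ys)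
    where
    exchange : ∀ i j k → i + (j + k) ≡ j + (i + k)
    exchange = solve-∀
    row : (ys : List B) → count (R? x) ys + sum (map (λ b → count (λ a → R? a b) xs) ys)
                        ≡ sum (map (λ b → count (λ a → R? a b) (x ∷ xs)) ys)
    row []       = refl
    row (y ∷ ys) with R? x y
    ... | yes _ = cong suc (trans (exchange (count (R? x) ys) (count (λ a → R? a y) xs) _)
                                  (cong (_+_ (count (λ a → R? a y) xs)) (row ys)))
    ... | no  _ = trans (exchange (count (R? x) ys) (count (λ a → R? a y) xs) _)
                        (cong (_+_ (count (λ a → R? a y) xs)) (row ys))

  -- The choices whose entries all satisfy `P` are the choices from the filtered list: those that
  -- begin with a rejected entry are lost together.
  count-choose : {P : Pred A 0ℓ} (P? : Decidable P) (k : ℕ) (xs : List A) →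
                 count (All.all? P?) (choose k xs) ≡ count P? xs C k
  count-choose {A = A} {P = P} P? k xs = trans (all-choose k xs) (length-choose k (filter P? xs))
    where
    none : ∀ {x} → ¬ P x → (css : List (List A)) → count (All.all? P? ∘ (x ∷_)) css ≡ 0
    none ¬p css = cong length (List.filter-none (All.all? P? ∘ (_ ∷_))
                                (All.universal (λ _ → λ { (p ∷ _) → ¬p p }) css))
    all-choose : ∀ k xs → count (All.all? P?) (choose k xs) ≡ length (choose k (filter P? xs))
    all-choose zero    xs       = refl
    all-choose (suc k) []       = refl
    all-choose (suc k) (x ∷ xs) with P? x in eq
    ... | yes p = trans (count-++ (All.all? P?) (map (x ∷_) (choose k xs)) _)
      (trans (cong₂ _+_
        (trans (count-map (All.all? P?) (x ∷_) (choose k xs))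
          (trans (count-cong (All.all? P? ∘ (x ∷_)) (All.all? P?) (λ { (_ ∷ ps) → ps }) (p ∷_) (choose k xs))
            (trans (all-choose k xs) (sym (List.length-map (x ∷_) (choose k (filter P? xs)))))))
        (all-choose (suc k) xs))
      (sym (List.length-++ (map (x ∷_) (choose k (filter P? xs))))))
    ... | no ¬p = trans (count-++ (All.all? P?) (map (x ∷_) (choose k xs)) _)
      (cong₂ _+_ (trans (count-map (All.all? P?) (x ∷_) (choose k xs)) (none ¬p (choose k xs)))
                 (all-choose (suc k) xs))

  attacks-self : ∀ {n} (x : Space n) → Attacks x x
  attacks-self (x₁ , x₂ , x₃) = inj₁ (cong₂ ℤ._+_
    (cong₂ ℤ._+_ (ℤ.+-inverseʳ (coord x₁)) (ℤ.+-inverseʳ (coord x₂))) (ℤ.+-inverseʳ (coord x₃)))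

  nonAttackers : ∀ {n} → Space n → ℕ
  nonAttackers {n} x = count (λ a → ¬? (attacks? a x)) (spaces n)

  nonAttackers+attackers : ∀ {n} (x : Space n) → nonAttackers x + attackers x ≡ n ^ 3
  nonAttackers+attackers {n} x = trans (count-complement (λ a → attacks? a x) (spaces n)) (length-spaces n)

  -- A piece attacks its own space, so `x` is safe exactly when all n pieces are chosen among the
  -- non-attackers of `x`.
  count-safe : ∀ {n} (x : Space n) → count (λ c → safe? c x) (configurations n) ≡ nonAttackers x C n
  count-safe {n} x = trans
    (count-cong (λ c → safe? c x) (All.all? (λ a → ¬? (attacks? a x))) proj₂
      (λ safe → (λ x∈c → All.lookup safe x∈c (attacks-self x)) , safe) (configurations n))
    (count-choose (λ a → ¬? (attacks? a x)) n (spaces n))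

  sum-numSafe : ∀ n → sum (map numSafe (configurations n)) ≡ sum (map (λ x → nonAttackers x C n) (spaces n))
  sum-numSafe n = trans (count-comm safe? (configurations n) (spaces n))
    (cong sum (List.map-cong count-safe (spaces n)))

  -- The recursion behind the product formula for binomial coefficients. Truncated subtraction is
  -- correct here, as both sides vanish for k ≥ m.
  [k+1]*mC[k+1] : ∀ m k → suc k * (m C suc k) ≡ (m ∸ k) * (m C k)
  [k+1]*mC[k+1] zero    k       = trans (*-zeroʳ (suc k)) (cong (_* (0 C k)) (sym (0∸n≡0 k)))
  [k+1]*mC[k+1] (suc m) zero    = begin
    1 * (suc m C 1)             ≡⟨ cong (1 *_) (nCk+nC[k+1]≡[n+1]C[k+1] m 0) ⟨
    1 * (1 + m C 1)             ≡⟨ *-distribˡ-+ 1 1 (m C 1) ⟩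
    1 + 1 * (m C 1)             ≡⟨ cong suc ([k+1]*mC[k+1] m 0) ⟩
    suc m * 1                   ∎
    where open ≡-Reasoning
  [k+1]*mC[k+1] (suc m) (suc k) = begin
    suc (suc k) * (suc m C suc (suc k))                          ≡⟨ cong (suc (suc k) *_) (nCk+nC[k+1]≡[n+1]C[k+1] m (suc k)) ⟨
    suc (suc k) * (c + m C suc (suc k))                          ≡⟨ *-distribˡ-+ (suc (suc k)) c _ ⟩
    suc (suc k) * c + suc (suc k) * (m C suc (suc k))            ≡⟨ cong (_+_ (suc (suc k) * c)) ([k+1]*mC[k+1] m (suc k)) ⟩
    suc (suc k) * c + (m ∸ suc k) * c                            ≡⟨ carry ⟩
    suc k * c + (m ∸ k) * c                                      ≡⟨ cong (_+ (m ∸ k) * c) ([k+1]*mC[k+1] m k) ⟩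
    (m ∸ k) * (m C k) + (m ∸ k) * c                              ≡⟨ *-distribˡ-+ (m ∸ k) (m C k) c ⟨
    (m ∸ k) * (m C k + c)                                        ≡⟨ cong ((m ∸ k) *_) (nCk+nC[k+1]≡[n+1]C[k+1] m k) ⟩
    (m ∸ k) * (suc m C suc k)                                    ∎
    where
    open ≡-Reasoning
    c = m C suc k
    shuffle : ∀ k c d → suc (suc k) * c + d * c ≡ suc k * c + suc d * c
    shuffle = solve-∀
    carry : suc (suc k) * c + (m ∸ suc k) * c ≡ suc k * c + (m ∸ k) * c
    -- For m ≤ k the truncated difference no longer drops by one, but then `c` is 0 by the identity
    -- for `m` and `k`.
    carry with k <? m
    ... | yes k<m = trans (shuffle k c (m ∸ suc k)) (cong (λ d → suc k * c + d * c) (sym (+-∸-assoc 1 k<m)))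
    ... | no  k≮m = trans (cong₂ _+_ (vanish (suc (suc k))) (vanish (m ∸ suc k)))
                          (sym (cong₂ _+_ (vanish (suc k)) (vanish (m ∸ k))))
      where
      c≡0 : c ≡ 0
      c≡0 = m*n≡0⇒m≡0 c (suc k) (trans (*-comm c (suc k)) (trans ([k+1]*mC[k+1] m k) (cong (_* (m C k)) (m≤n⇒m∸n≡0 (≮⇒≥ k≮m)))))
      vanish : ∀ i → i * c ≡ 0
      vanish i = trans (cong (i *_) c≡0) (*-zeroʳ i)

  private
    interchange : ∀ i j k l → (i * j) * (k * l) ≡ (i * k) * (j * l)
    interchange = solve-∀

  mCk*p^k-step : ∀ {m p k x y} → (m ∸ k) * x ≤ (p ∸ k) * y → (m C k) * x ^ k ≤ (p C k) * y ^ k →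
                 (m C suc k) * x ^ suc k ≤ (p C suc k) * y ^ suc k
  mCk*p^k-step {m} {p} {k} {x} {y} factor ih = *-cancelˡ-≤ (suc k) (begin
    suc k * ((m C suc k) * x ^ suc k)     ≡⟨ *-assoc (suc k) (m C suc k) (x ^ suc k) ⟨
    suc k * (m C suc k) * (x * x ^ k)     ≡⟨ cong (_* (x * x ^ k)) ([k+1]*mC[k+1] m k) ⟩
    (m ∸ k) * (m C k) * (x * x ^ k)       ≡⟨ interchange (m ∸ k) (m C k) x (x ^ k) ⟩
    (m ∸ k) * x * ((m C k) * x ^ k)       ≤⟨ *-mono-≤ factor ih ⟩
    (p ∸ k) * y * ((p C k) * y ^ k)       ≡⟨ interchange (p ∸ k) y (p C k) (y ^ k) ⟩
    (p ∸ k) * (p C k) * (y * y ^ k)       ≡⟨ cong (_* (y * y ^ k)) ([k+1]*mC[k+1] p k) ⟨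
    suc k * (p C suc k) * (y * y ^ k)     ≡⟨ *-assoc (suc k) (p C suc k) (y ^ suc k) ⟩
    suc k * ((p C suc k) * y ^ suc k)     ∎)
    where open ≤-Reasoning

  -- Multiplied out form of C(m, k) / C(p, k) ≤ (m / p)^k: subtracting the same amount from both
  -- terms of a ratio at most 1 does not increase it.
  mCk*p^k≤pCk*m^k : ∀ {m p} → m ≤ p → ∀ k → (m C k) * p ^ k ≤ (p C k) * m ^ k
  mCk*p^k≤pCk*m^k m≤p zero    = ≤-refl
  mCk*p^k≤pCk*m^k {m} {p} m≤p (suc k) = mCk*p^k-step {m} {p} {k} {p} {m} factor (mCk*p^k≤pCk*m^k m≤p k)
    where
    open ≤-Reasoning
    factor : (m ∸ k) * p ≤ (p ∸ k) * m
    factor = begin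
      (m ∸ k) * p       ≡⟨ *-distribʳ-∸ p m k ⟩
      m * p ∸ k * p     ≤⟨ ∸-monoʳ-≤ (m * p) (*-monoʳ-≤ k m≤p) ⟩
      m * p ∸ k * m     ≡⟨ cong (_∸ k * m) (*-comm m p) ⟩
      p * m ∸ k * m     ≡⟨ *-distribʳ-∸ m p k ⟨
      (p ∸ k) * m       ∎

  -- The ratios (m - i) / (p - i) decrease in i, so those with i < l are at least (m - l) / (p - l).
  -- The bound `l` stays fixed while `k` grows; both are n in the application.
  pCk*[m∸l]^k≤mCk*[p∸l]^k : ∀ {m p l} → m ≤ p → ∀ k → k ≤ l → (p C k) * (m ∸ l) ^ k ≤ (m C k) * (p ∸ l) ^ k
  pCk*[m∸l]^k≤mCk*[p∸l]^k m≤p zero    k≤l = ≤-refl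
  pCk*[m∸l]^k≤mCk*[p∸l]^k {m} {p} {l} m≤p (suc k) k<l =
    mCk*p^k-step {p} {m} {k} {m ∸ l} {p ∸ l} factor (pCk*[m∸l]^k≤mCk*[p∸l]^k m≤p k (<⇒≤ k<l))
    where
    open ≤-Reasoning
    split : ∀ {i} → l ≤ i → i ∸ k ≡ (l ∸ k) + (i ∸ l)
    split {i} l≤i = trans (cong (_∸ k) (sym (m+[n∸m]≡n l≤i))) (+-∸-comm (i ∸ l) (<⇒≤ k<l))
    factor : (p ∸ k) * (m ∸ l) ≤ (m ∸ k) * (p ∸ l)
    factor with ≤-total l m
    ... | inj₂ m≤l = ≤-trans (≤-reflexive (trans (cong ((p ∸ k) *_) (m≤n⇒m∸n≡0 m≤l)) (*-zeroʳ (p ∸ k)))) z≤n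
    ... | inj₁ l≤m = begin
      (p ∸ k) * (m ∸ l)                               ≡⟨ cong (_* (m ∸ l)) (split (≤-trans l≤m m≤p)) ⟩
      ((l ∸ k) + (p ∸ l)) * (m ∸ l)                   ≡⟨ *-distribʳ-+ (m ∸ l) (l ∸ k) (p ∸ l) ⟩
      (l ∸ k) * (m ∸ l) + (p ∸ l) * (m ∸ l)           ≤⟨ +-mono-≤ (*-monoʳ-≤ (l ∸ k) (∸-monoˡ-≤ l m≤p)) (≤-reflexive (*-comm (p ∸ l) (m ∸ l))) ⟩
      (l ∸ k) * (p ∸ l) + (m ∸ l) * (p ∸ l)           ≡⟨ *-distribʳ-+ (p ∸ l) (l ∸ k) (m ∸ l) ⟨
      ((l ∸ k) + (m ∸ l)) * (p ∸ l)                   ≡⟨ cong (_* (p ∸ l)) (split l≤m) ⟨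
      (m ∸ k) * (p ∸ l)                               ∎

module Asymptotics where

  open import Algebra.Definitions.RawSemiring ℚ.+-*-rawSemiring using (_^_)
  open import Algebra.Properties.CommutativeSemiring.Exp
    (CommutativeRing.commutativeSemiring ℚ.+-*-commutativeRing) using (^-distrib-*)
  open import Data.Nat.ListAction using (sum)
  open import Data.Rational.Base
  open import Data.Rational.Properties
  open import Data.Rational.Solver using (module +-*-Solver)
  open +-*-Solver using (Polynomial; con; solve; _:=_; _:+_; _:*_; _:-_; :-_)
  open Counting using (attackers; attackers-≤; attackers-≥)
  open Configurations

  -- Ordered arithmetic of the rationals.

  ≤-by : ∀ {p q r} → 0ℚ ≤ r → q - p ≡ r → p ≤ q
  ≤-by {p} {q} {r} 0≤r q-p≡r = begin
    p             ≡⟨ +-identityʳ p ⟨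
    p + 0ℚ        ≤⟨ +-monoʳ-≤ p 0≤r ⟩
    p + r         ≡⟨ cong (_+_ p) q-p≡r ⟨
    p + (q - p)   ≡⟨ solve 2 (λ p q → p :+ (q :- p) := q) refl p q ⟩
    q             ∎
    where open ≤-Reasoning

  p≤q⇒0≤q-p : ∀ {p q} → p ≤ q → 0ℚ ≤ q - p
  p≤q⇒0≤q-p {p} {q} p≤q = subst (_≤ q - p) (+-inverseʳ p) (+-monoˡ-≤ (- p) p≤q)

  +-nonNeg : ∀ {p q} → 0ℚ ≤ p → 0ℚ ≤ q → 0ℚ ≤ p + q
  +-nonNeg = +-mono-≤

  *-monoˡ : ∀ {p q r} → 0ℚ ≤ r → p ≤ q → r * p ≤ r * q
  *-monoˡ {r = r} 0≤r = *-monoˡ-≤-nonNeg r {{nonNegative 0≤r}}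

  *-monoʳ : ∀ {p q r} → 0ℚ ≤ r → p ≤ q → p * r ≤ q * r
  *-monoʳ {r = r} 0≤r = *-monoʳ-≤-nonNeg r {{nonNegative 0≤r}}

  *-nonNeg : ∀ {p q} → 0ℚ ≤ p → 0ℚ ≤ q → 0ℚ ≤ p * q
  *-nonNeg {p} {q} 0≤p 0≤q = subst (_≤ p * q) (*-zeroʳ p) (*-monoˡ 0≤p 0≤q)

  *-mono : ∀ {p q r s} → 0ℚ ≤ q → 0ℚ ≤ r → p ≤ q → r ≤ s → p * r ≤ q * s
  *-mono 0≤q 0≤r p≤q r≤s = ≤-trans (*-monoʳ 0≤r p≤q) (*-monoˡ 0≤q r≤s)

  ≤-dec : ∀ p q → {T (p ≤ᵇ q)} → p ≤ q
  ≤-dec p q {p≤q} = ≤ᵇ⇒≤ p≤q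

  0≤1 : 0ℚ ≤ 1ℚ
  0≤1 = ≤-dec 0ℚ 1ℚ

  ^-nonNeg : ∀ {p} → 0ℚ ≤ p → ∀ k → 0ℚ ≤ p ^ k
  ^-nonNeg 0≤p zero    = 0≤1
  ^-nonNeg 0≤p (suc k) = *-nonNeg 0≤p (^-nonNeg 0≤p k)

  ^-pos : ∀ {p} → 0ℚ < p → ∀ k → 0ℚ < p ^ k
  ^-pos 0<p zero    = positive⁻¹ 1ℚ
  ^-pos {p} 0<p (suc k) = positive⁻¹ (p * p ^ k) {{pos*pos⇒pos p {{positive 0<p}} (p ^ k) {{positive (^-pos 0<p k)}}}}

  ^-mono : ∀ {p q} → 0ℚ ≤ p → p ≤ q → ∀ k → p ^ k ≤ q ^ k
  ^-mono 0≤p p≤q zero    = ≤-refl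
  ^-mono 0≤p p≤q (suc k) = *-mono (≤-trans 0≤p p≤q) (^-nonNeg 0≤p k) p≤q (^-mono 0≤p p≤q k)

  fromℕ : ℕ → ℚ
  fromℕ n = + n / 1

  toℚᵘ-/ : ∀ i n .{{_ : ℕ.NonZero n}} → toℚᵘ (i / n) ℚᵘ.≃ (i ℚᵘ./ n)
  toℚᵘ-/ i (suc n) = toℚᵘ-fromℚᵘ (ℚᵘ.mkℚᵘ i n)

  fromℕ-+ : ∀ m n → fromℕ (m ℕ.+ n) ≡ fromℕ m + fromℕ n
  fromℕ-+ m n = toℚᵘ-injective (ℚᵘ.≃-trans (toℚᵘ-/ (+ (m ℕ.+ n)) 1) (ℚᵘ.≃-sym
    (ℚᵘ.≃-trans (toℚᵘ-homo-+ (fromℕ m) (fromℕ n))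
      (ℚᵘ.≃-trans (ℚᵘ.+-cong (toℚᵘ-/ (+ m) 1) (toℚᵘ-/ (+ n) 1))
        (ℚᵘ.*≡* (cong (ℤ._* + 1) (cong₂ ℤ._+_ (ℤ.*-identityʳ (+ m)) (ℤ.*-identityʳ (+ n)))))))))

  /≡fromℕ* : ∀ m n .{{_ : ℕ.NonZero n}} → + m / n ≡ fromℕ m * (+ 1 / n)
  /≡fromℕ* m (suc n) = toℚᵘ-injective (ℚᵘ.≃-trans (toℚᵘ-/ (+ m) (suc n)) (ℚᵘ.≃-sym
    (ℚᵘ.≃-trans (toℚᵘ-homo-* (fromℕ m) (+ 1 / suc n))
      (ℚᵘ.≃-trans (ℚᵘ.*-cong (toℚᵘ-/ (+ m) 1) (toℚᵘ-/ (+ 1) (suc n)))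
        (ℚᵘ.*≡* (cong₂ ℤ._*_ (ℤ.*-identityʳ (+ m)) (cong +_ (sym (ℕ.*-identityˡ (suc n))))))))))

  fromℕ-* : ∀ m n → fromℕ (m ℕ.* n) ≡ fromℕ m * fromℕ n
  fromℕ-* m n = toℚᵘ-injective (ℚᵘ.≃-trans (toℚᵘ-/ (+ (m ℕ.* n)) 1) (ℚᵘ.≃-sym
    (ℚᵘ.≃-trans (toℚᵘ-homo-* (fromℕ m) (fromℕ n))
      (ℚᵘ.≃-trans (ℚᵘ.*-cong (toℚᵘ-/ (+ m) 1) (toℚᵘ-/ (+ n) 1))
        (ℚᵘ.*≡* (cong (ℤ._* + 1) (sym (ℤ.pos-* m n))))))))

  fromℕ-^ : ∀ m k → fromℕ (m ℕ.^ k) ≡ fromℕ m ^ k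
  fromℕ-^ m zero    = refl
  fromℕ-^ m (suc k) = trans (fromℕ-* m (m ℕ.^ k)) (cong (fromℕ m *_) (fromℕ-^ m k))

  fromℕ-mono-≤ : ∀ {m n} → m ℕ.≤ n → fromℕ m ≤ fromℕ n
  fromℕ-mono-≤ {m} {n} m≤n = toℚᵘ-cancel-≤
    (ℚᵘ.≤-trans (ℚᵘ.≤-reflexive (toℚᵘ-/ (+ m) 1))
      (ℚᵘ.≤-trans (ℚᵘ.*≤* (ℤ.*-monoʳ-≤-nonNeg (+ 1) (ℤ.+≤+ m≤n)))
                  (ℚᵘ.≤-reflexive (ℚᵘ.≃-sym (toℚᵘ-/ (+ n) 1)))))

  0≤fromℕ : ∀ n → 0ℚ ≤ fromℕ n
  0≤fromℕ n = fromℕ-mono-≤ {0} {n} ℕ.z≤n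

  0<fromℕ : ∀ n .{{_ : ℕ.NonZero n}} → 0ℚ < fromℕ n
  0<fromℕ (suc n) = positive⁻¹ (fromℕ (suc n)) {{normalize-pos (suc n) 1}}

  0<1/n : ∀ n .{{_ : ℕ.NonZero n}} → 0ℚ < + 1 / n
  0<1/n (suc n) = positive⁻¹ (+ 1 / suc n) {{normalize-pos 1 (suc n)}}

  n*1/n : ∀ n .{{_ : ℕ.NonZero n}} → fromℕ n * (+ 1 / n) ≡ 1ℚ
  n*1/n (suc n) = trans (sym (/≡fromℕ* (suc n) (suc n))) (toℚᵘ-injective
    (ℚᵘ.≃-trans (toℚᵘ-/ (+ suc n) (suc n)) (ℚᵘ.*≡* (ℤ.*-comm (+ suc n) (+ 1)))))

  p-q≤p∸q : ∀ m n → fromℕ m - fromℕ n ≤ fromℕ (m ℕ.∸ n)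
  p-q≤p∸q m n = ≤-by (p≤q⇒0≤q-p (≤-trans (fromℕ-mono-≤ (ℕ.m≤n+m∸n m n)) (≤-reflexive (fromℕ-+ n (m ℕ.∸ n)))))
    (solve 3 (λ d m n → d :- (m :- n) := (n :+ d) :- m) refl (fromℕ (m ℕ.∸ n)) (fromℕ m) (fromℕ n))

  archimedean : ∀ p → ∃[ n ] p ≤ fromℕ n
  archimedean p@(mkℚ i d _) = ℤ.∣ i ∣ , toℚᵘ-cancel-≤
    (ℚᵘ.≤-trans (ℚᵘ.*≤* (le i)) (ℚᵘ.≤-reflexive (ℚᵘ.≃-sym (toℚᵘ-/ (+ ℤ.∣ i ∣) 1))))
    where
    le : ∀ i → i ℤ.* + 1 ℤ.≤ + ℤ.∣ i ∣ ℤ.* + suc d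
    le (+ n)    = subst₂ ℤ._≤_ (sym (ℤ.*-identityʳ (+ n))) (ℤ.pos-* n (suc d)) (ℤ.+≤+ (ℕ.m≤m*n n (suc d)))
    le -[1+ n ] = ℤ.-≤+

  eventually-*1/n≤ : ∀ c {δ} → 0ℚ < δ → ∃[ N ] (∀ n .{{_ : ℕ.NonZero n}} → N ℕ.≤ n → c * (+ 1 / n) ≤ δ)
  eventually-*1/n≤ c {δ} 0<δ = proj₁ (archimedean (c * δ⁻¹)) , λ n N≤n → begin
    c * (+ 1 / n)                    ≡⟨ cong (_* (+ 1 / n)) (trans (cong (c *_) (*-inverseˡ δ)) (*-identityʳ c)) ⟨
    c * (δ⁻¹ * δ) * (+ 1 / n)        ≡⟨ solve 4 (λ c i d e → c :* (i :* d) :* e := c :* i :* (d :* e)) refl c δ⁻¹ δ (+ 1 / n) ⟩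
    c * δ⁻¹ * (δ * (+ 1 / n))        ≤⟨ *-monoʳ (*-nonNeg (<⇒≤ 0<δ) (<⇒≤ (0<1/n n)))
                                          (≤-trans (proj₂ (archimedean (c * δ⁻¹))) (fromℕ-mono-≤ N≤n)) ⟩
    fromℕ n * (δ * (+ 1 / n))        ≡⟨ solve 3 (λ n d e → n :* (d :* e) := d :* (n :* e)) refl (fromℕ n) δ (+ 1 / n) ⟩
    δ * (fromℕ n * (+ 1 / n))        ≡⟨ cong (δ *_) (n*1/n n) ⟩
    δ * 1ℚ                           ≡⟨ *-identityʳ δ ⟩
    δ                                ∎
    where
    open ≤-Reasoning
    instance
      δ≢0 = >-nonZero 0<δ
    δ⁻¹ = 1/ δ

  -- Bernoulli's inequality and the partial sums of the exponential series.

  -- The tangent of the power at `p`, for increments `q` of either sign; the induction step gives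
  -- away exactly (k + 1) q² p^k.
  bernoulli : ∀ {p q} → 0ℚ ≤ p → 0ℚ ≤ p + q → ∀ k →
              p ^ suc k + fromℕ (suc k) * q * p ^ k ≤ (p + q) ^ suc k
  bernoulli {p} {q} 0≤p 0≤p+q zero = ≤-reflexive
    (solve 2 (λ p q → p :* con 1ℚ :+ con 1ℚ :* q :* con 1ℚ := (p :+ q) :* con 1ℚ) refl p q)
  bernoulli {p} {q} 0≤p 0≤p+q (suc k) = ≤-trans
    (≤-by (*-nonNeg (*-nonNeg (0≤fromℕ (suc k)) (square q)) (^-nonNeg 0≤p k)) (trans
      (cong (λ n → (p + q) * (p * p ^ k + fromℕ (suc k) * q * p ^ k) - (p * (p * p ^ k) + n * q * (p * p ^ k)))
            (fromℕ-+ 1 (suc k)))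
      (solve 4 (λ p q x n → (p :+ q) :* (p :* x :+ n :* q :* x) :- (p :* (p :* x) :+ (con 1ℚ :+ n) :* q :* (p :* x))
                            := n :* (q :* q) :* x) refl p q (p ^ k) (fromℕ (suc k)))))
    (*-monoˡ 0≤p+q (bernoulli 0≤p 0≤p+q k))
    where
    square : ∀ q → 0ℚ ≤ q * q
    square q = subst (0ℚ ≤_) (∣p∣*∣p∣≡p*p q) (*-nonNeg (0≤∣p∣ q) (0≤∣p∣ q))
      where
      ∣p∣*∣p∣≡p*p : ∀ q → ∣ q ∣ * ∣ q ∣ ≡ q * q
      ∣p∣*∣p∣≡p*p q with ∣p∣≡p∨∣p∣≡-p q
      ... | inj₁ eq = cong₂ _*_ eq eq
      ... | inj₂ eq = trans (cong₂ _*_ eq eq) (solve 1 (λ q → (:- q) :* (:- q) := q :* q) refl q)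

  1-nz≤[1-z]^n : ∀ {z} → 0ℚ ≤ z → z ≤ 1ℚ → ∀ n → 1ℚ - fromℕ n * z ≤ (1ℚ - z) ^ n
  1-nz≤[1-z]^n {z} 0≤z z≤1 zero    = ≤-reflexive (solve 1 (λ z → con 1ℚ :- con 0ℚ :* z := con 1ℚ) refl z)
  1-nz≤[1-z]^n {z} 0≤z z≤1 (suc n) = ≤-trans
    (≤-by (*-nonNeg (*-nonNeg (0≤fromℕ n) 0≤z) 0≤z) (trans
      (cong (λ m → (1ℚ - z) * (1ℚ - fromℕ n * z) - (1ℚ - m * z)) (fromℕ-+ 1 n))
      (solve 2 (λ z n → (con 1ℚ :- z) :* (con 1ℚ :- n :* z) :- (con 1ℚ :- (con 1ℚ :+ n) :* z) := n :* z :* z)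
         refl z (fromℕ n))))
    (*-monoˡ (p≤q⇒0≤q-p z≤1) (1-nz≤[1-z]^n 0≤z z≤1 n))

  1/k! : ℕ → ℚ
  1/k! k = (+ 1 / (k !)) {{k ℕ.!≢0}}

  0≤1/k! : ∀ k → 0ℚ ≤ 1/k! k
  0≤1/k! k = <⇒≤ (0<1/n (k !) {{k ℕ.!≢0}})

  [k+1]*1/[k+1]! : ∀ k → fromℕ (suc k) * 1/k! (suc k) ≡ 1/k! k
  [k+1]*1/[k+1]! k = begin
    a * g′                ≡⟨ *-identityʳ (a * g′) ⟨
    a * g′ * 1ℚ           ≡⟨ cong (a * g′ *_) (n*1/n (k !) {{k ℕ.!≢0}}) ⟨
    a * g′ * (f * g)      ≡⟨ solve 4 (λ a g′ f g → a :* g′ :* (f :* g) := a :* f :* g′ :* g) refl a g′ f g ⟩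
    a * f * g′ * g        ≡⟨ cong (λ x → x * g′ * g) (fromℕ-* (suc k) (k !)) ⟨
    fromℕ (suc k !) * g′ * g ≡⟨ cong (_* g) (n*1/n (suc k !) {{suc k ℕ.!≢0}}) ⟩
    1ℚ * g                ≡⟨ *-identityˡ g ⟩
    g                     ∎
    where
    open ≡-Reasoning
    a = fromℕ (suc k)
    f = fromℕ (k !)
    g = 1/k! k
    g′ = 1/k! (suc k)

  expTerm-nonNeg : ∀ {x} → 0ℚ ≤ x → ∀ k → 0ℚ ≤ expTerm x k
  expTerm-nonNeg 0≤x k = *-nonNeg (^-nonNeg 0≤x k) (0≤1/k! k)

  -- Bernoulli divided by (k + 1)!, since (k + 1) / (k + 1)! = 1 / k!.
  expTerm-shift : ∀ {x h} → 0ℚ ≤ x → 0ℚ ≤ x + h → ∀ k →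
                  expTerm x (suc k) + h * expTerm x k ≤ expTerm (x + h) (suc k)
  expTerm-shift {x} {h} 0≤x 0≤x+h k = ≤-trans
    (≤-reflexive (trans
      (cong (λ g → x ^ suc k * 1/k! (suc k) + h * (x ^ k * g)) (sym ([k+1]*1/[k+1]! k)))
      (solve 5 (λ p h x a g → p :* g :+ h :* (x :* (a :* g)) := (p :+ a :* h :* x) :* g) refl
         (x ^ suc k) h (x ^ k) (fromℕ (suc k)) (1/k! (suc k)))))
    (*-monoʳ (0≤1/k! (suc k)) (bernoulli 0≤x 0≤x+h k))

  -- expSum _ k is the derivative of the convex expSum _ (suc k), whose tangent at x
  -- lies below its graph.
  expSum-shift : ∀ {x h} → 0ℚ ≤ x → 0ℚ ≤ x + h → ∀ k →
                 expSum x (suc k) + h * expSum x k ≤ expSum (x + h) (suc k)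
  expSum-shift {x} {h} 0≤x 0≤x+h zero = ≤-trans
    (≤-reflexive (+-assoc (expTerm x 0) (expTerm x 1) (h * expTerm x 0)))
    (+-monoʳ-≤ (expTerm x 0) (expTerm-shift 0≤x 0≤x+h 0))
  expSum-shift {x} {h} 0≤x 0≤x+h (suc k) = ≤-trans
    (≤-reflexive (solve 5 (λ s t h s′ t′ → (s :+ t) :+ h :* (s′ :+ t′) := (s :+ h :* s′) :+ (t :+ h :* t′)) refl
      (expSum x (suc k)) (expTerm x (suc (suc k))) h (expSum x k) (expTerm x (suc k))))
    (+-mono-≤ (expSum-shift 0≤x 0≤x+h k) (expTerm-shift 0≤x 0≤x+h (suc k)))

  expSum-suc : ∀ {x} → 0ℚ ≤ x → ∀ k → expSum x k ≤ expSum x (suc k)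
  expSum-suc {x} 0≤x k = ≤-by (expTerm-nonNeg 0≤x (suc k))
    (solve 2 (λ s t → (s :+ t) :- s := t) refl (expSum x k) (expTerm x (suc k)))

  1≤expSum : ∀ {x} → 0ℚ ≤ x → ∀ k → 1ℚ ≤ expSum x k
  1≤expSum 0≤x zero    = ≤-refl
  1≤expSum 0≤x (suc k) = ≤-trans (1≤expSum 0≤x k) (expSum-suc 0≤x k)

  expSum-0 : ∀ k → expSum 0ℚ k ≡ 1ℚ
  expSum-0 zero    = refl
  expSum-0 (suc k) = cong₂ _+_ (expSum-0 k)
    (trans (cong (_* 1/k! (suc k)) (*-zeroˡ (0ℚ ^ k))) (*-zeroˡ (1/k! (suc k))))

  -- The tangent at `x + y`, followed back by `y`, stays below the graph. Its slope is the partial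
  -- sum of order one less, which is at most the sum `s′` itself.
  [1-y]*expSum≤ : ∀ {x y} → 0ℚ ≤ x → 0ℚ ≤ y → ∀ k → (1ℚ - y) * expSum (x + y) k ≤ expSum x k
  [1-y]*expSum≤ {x} {y} 0≤x 0≤y zero = ≤-by 0≤y (solve 1 (λ y → con 1ℚ :- (con 1ℚ :- y) :* con 1ℚ := y) refl y)
  [1-y]*expSum≤ {x} {y} 0≤x 0≤y (suc k) = begin
    (1ℚ - y) * s′                            ≤⟨ ≤-by (*-nonNeg 0≤y (p≤q⇒0≤q-p (expSum-suc 0≤x+y k)))
                                                 (solve 3 (λ y s s′ → (s′ :+ (:- y) :* s) :- (con 1ℚ :- y) :* s′ := y :* (s′ :- s)) refl y s s′) ⟩
    s′ + (- y) * s                           ≤⟨ expSum-shift {x + y} { - y} 0≤x+y (≤-trans 0≤x (≤-reflexive (sym back))) k ⟩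
    expSum (x + y - y) (suc k)               ≡⟨ cong (λ x → expSum x (suc k)) back ⟩
    expSum x (suc k)                         ∎
    where
    open ≤-Reasoning
    s = expSum (x + y) k
    s′ = expSum (x + y) (suc k)
    0≤x+y = +-nonNeg 0≤x 0≤y
    back : x + y - y ≡ x
    back = solve 2 (λ x y → x :+ y :- y := x) refl x y

  fromℕ-suc-* : ∀ n y → fromℕ (suc n) * y ≡ fromℕ n * y + y
  fromℕ-suc-* n y = trans (cong (_* y) (fromℕ-+ 1 n))
    (solve 2 (λ n y → (con 1ℚ :+ n) :* y := n :* y :+ y) refl (fromℕ n) y)

  -- Each factor `1 - y` moves the argument down by `y` at the same order, until it reaches 0, where
  -- every partial sum is 1.
  [1-y]^n*expSum≤1 : ∀ {y} → 0ℚ ≤ y → y ≤ 1ℚ → ∀ n k → (1ℚ - y) ^ n * expSum (fromℕ n * y) k ≤ 1ℚ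
  [1-y]^n*expSum≤1 {y} 0≤y y≤1 zero k = ≤-reflexive
    (trans (*-identityˡ _) (trans (cong (λ x → expSum x k) (*-zeroˡ y)) (expSum-0 k)))
  [1-y]^n*expSum≤1 {y} 0≤y y≤1 (suc n) k = begin
    (1ℚ - y) * (1ℚ - y) ^ n * expSum (fromℕ (suc n) * y) k   ≡⟨ cong (λ x → (1ℚ - y) * (1ℚ - y) ^ n * expSum x k) (fromℕ-suc-* n y) ⟩
    (1ℚ - y) * (1ℚ - y) ^ n * s                              ≡⟨ solve 3 (λ a b s → a :* b :* s := b :* (a :* s)) refl (1ℚ - y) ((1ℚ - y) ^ n) s ⟩
    (1ℚ - y) ^ n * ((1ℚ - y) * s)                            ≤⟨ *-monoˡ (^-nonNeg (p≤q⇒0≤q-p y≤1) n)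
                                                                  ([1-y]*expSum≤ (*-nonNeg (0≤fromℕ n) 0≤y) 0≤y k) ⟩
    (1ℚ - y) ^ n * expSum (fromℕ n * y) k                    ≤⟨ [1-y]^n*expSum≤1 0≤y y≤1 n k ⟩
    1ℚ                                                       ∎
    where
    open ≤-Reasoning
    s = expSum (fromℕ n * y + y) k

  -- Each factor `1 + y` moves the argument up by `y` at the price of one more term, so n factors
  -- end in order n.
  [1+y]^n≤expSum : ∀ {y} → 0ℚ ≤ y → ∀ n → (1ℚ + y) ^ n ≤ expSum (fromℕ n * y) n
  [1+y]^n≤expSum {y} 0≤y zero    = ≤-refl
  [1+y]^n≤expSum {y} 0≤y (suc n) = begin
    (1ℚ + y) * (1ℚ + y) ^ n               ≤⟨ *-monoˡ (+-nonNeg 0≤1 0≤y) ([1+y]^n≤expSum 0≤y n) ⟩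
    (1ℚ + y) * s                          ≡⟨ solve 2 (λ y s → (con 1ℚ :+ y) :* s := s :+ y :* s) refl y s ⟩
    s + y * s                             ≤⟨ +-monoˡ-≤ (y * s) (expSum-suc 0≤ny n) ⟩
    expSum (fromℕ n * y) (suc n) + y * s  ≤⟨ expSum-shift 0≤ny (+-nonNeg 0≤ny 0≤y) n ⟩
    expSum (fromℕ n * y + y) (suc n)      ≡⟨ cong (λ x → expSum x (suc n)) (fromℕ-suc-* n y) ⟨
    expSum (fromℕ (suc n) * y) (suc n)    ∎
    where
    open ≤-Reasoning
    s = expSum (fromℕ n * y) n
    0≤ny = *-nonNeg (0≤fromℕ n) 0≤y

  private
    nat : ∀ {m} → ℕ → Polynomial m
    nat n = con (fromℕ n)

  -- The proportion of configurations that leave one space safe.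

  module _ (n : ℕ) .{{_ : ℕ.NonZero n}} (13≤n : 13 ℕ.≤ n) where
    private
      ν = fromℕ n
      ε = + 1 / n

      νε≡1 : ν * ε ≡ 1ℚ
      νε≡1 = n*1/n n

      0≤ν : 0ℚ ≤ ν
      0≤ν = 0≤fromℕ n

      0≤ε : 0ℚ ≤ ε
      0≤ε = <⇒≤ (0<1/n n)

      0≤ν-13 : 0ℚ ≤ ν - fromℕ 13
      0≤ν-13 = p≤q⇒0≤q-p (fromℕ-mono-≤ 13≤n)

      0≤1-13ε : 0ℚ ≤ 1ℚ - fromℕ 13 * ε
      0≤1-13ε = p≤q⇒0≤q-p (≤-trans (*-monoʳ 0≤ε (fromℕ-mono-≤ 13≤n)) (≤-reflexive νε≡1))

      cε≤1 : ∀ c → {T (c ≤ᵇ fromℕ 13)} → c * ε ≤ 1ℚ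
      cε≤1 c {c≤13} = ≤-by (+-nonNeg (*-nonNeg (p≤q⇒0≤q-p (≤-dec c (fromℕ 13) {c≤13})) 0≤ε) 0≤1-13ε)
        (solve 2 (λ c e → con 1ℚ :- c :* e := (nat 13 :- c) :* e :+ (con 1ℚ :- nat 13 :* e)) refl c ε)

      cε²≤1 : ∀ c → {T (0ℚ ≤ᵇ c)} → {T (c ≤ᵇ fromℕ 13)} → c * (ε * ε) ≤ 1ℚ
      cε²≤1 c {0≤c} {c≤13} = ≤-trans (≤-reflexive (sym (*-assoc c ε ε)))
        (*-mono 0≤1 0≤ε (cε≤1 c {c≤13}) (≤-trans (≤-reflexive (sym (*-identityˡ ε))) (cε≤1 1ℚ)))

      0≤cε² : ∀ c → {T (0ℚ ≤ᵇ c)} → 0ℚ ≤ c * (ε * ε)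
      0≤cε² c {0≤c} = *-nonNeg (≤-dec 0ℚ c {0≤c}) (*-nonNeg 0≤ε 0≤ε)

      -- The total price, over n pieces, of a relative error c / n² in a single ratio.
      1-cε≤[1-cε²]^n : ∀ c → {T (0ℚ ≤ᵇ c)} → {T (c ≤ᵇ fromℕ 13)} → 1ℚ - c * ε ≤ (1ℚ - c * (ε * ε)) ^ n
      1-cε≤[1-cε²]^n c {0≤c} {c≤13} = ≤-trans (≤-reflexive (cong (λ p → 1ℚ - p) (sym (trans
          (solve 3 (λ c ν e → ν :* (c :* (e :* e)) := c :* (ν :* e) :* e) refl c ν ε)
          (cong (_* ε) (trans (cong (c *_) νε≡1) (*-identityʳ c)))))))
        (1-nz≤[1-z]^n (0≤cε² c {0≤c}) (cε²≤1 c {0≤c} {c≤13}) n)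

      V : ℚ
      V = fromℕ (n ℕ.^ 3)

      V≡ν³ : V ≡ ν * ν * ν
      V≡ν³ = trans (fromℕ-^ n 3) (solve 1 (λ ν → ν :* (ν :* (ν :* con 1ℚ)) := ν :* ν :* ν) refl ν)

      0<V : 0ℚ < V
      0<V = 0<fromℕ (n ℕ.^ 3) {{n^3≢0 n}}

      0<V-ν : 0ℚ < V - ν
      -- The constants come from dividing ν³ - ν - 13 by ν - 13: 168 = 13² - 1 and 2171 = 13 * 168 -
      -- 13.
      0<V-ν = <-≤-trans (positive⁻¹ (fromℕ 13)) (≤-by
        (+-nonNeg (*-nonNeg (*-nonNeg 0≤ν (+-nonNeg 0≤ν (≤-dec 0ℚ (fromℕ 13)))) 0≤ν-13)
                  (+-nonNeg (*-nonNeg (≤-dec 0ℚ (fromℕ 168)) 0≤ν-13) (≤-dec 0ℚ (fromℕ 2171))))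
        (trans (cong (λ V → V - ν - fromℕ 13) V≡ν³)
          (solve 1 (λ ν → ν :* ν :* ν :- ν :- nat 13 :=
             ν :* (ν :+ nat 13) :* (ν :- nat 13) :+ (nat 168 :* (ν :- nat 13) :+ nat 2171)) refl ν)))

    module _ (x : Space n) where
      private
        m = nonAttackers x
        M = fromℕ m
        A = fromℕ (attackers x)

        m≤n³ : m ℕ.≤ n ℕ.^ 3
        m≤n³ = ℕ.≤-trans (ℕ.m≤m+n m (attackers x)) (ℕ.≤-reflexive (nonAttackers+attackers x))

        M≡ν³-A : M ≡ ν * ν * ν - A
        M≡ν³-A = trans (solve 2 (λ M A → M := (M :+ A) :- A) refl M A)
          (cong (λ p → p - A) (trans (sym (fromℕ-+ m (attackers x)))
                              (trans (cong fromℕ (nonAttackers+attackers x)) V≡ν³)))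

        A≤ : A ≤ fromℕ 3 * (ν * ν) + fromℕ 2 * ν
        A≤ = subst (A ≤_)
          (trans (fromℕ-+ (3 ℕ.* (n ℕ.* n)) (2 ℕ.* n)) (cong₂ _+_
            (trans (fromℕ-* 3 (n ℕ.* n)) (cong (fromℕ 3 *_) (fromℕ-* n n))) (fromℕ-* 2 n)))
          (fromℕ-mono-≤ (ℤ.drop‿+≤+ (subst (+ attackers x ℤ.≤_)
            (sym (cong₂ ℤ._+_ (trans (ℤ.pos-* 3 (n ℕ.* n)) (cong (+ 3 ℤ.*_) (ℤ.pos-* n n))) (ℤ.pos-* 2 n)))
            (attackers-≤ (proj₁ x) (proj₁ (proj₂ x)) (proj₂ (proj₂ x))))))

        ≤A : fromℕ 3 * (ν * ν) ≤ fromℕ 2 * A + fromℕ 12 * ν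
        ≤A = subst₂ _≤_
          (trans (fromℕ-* 3 (n ℕ.* n)) (cong (fromℕ 3 *_) (fromℕ-* n n)))
          (trans (fromℕ-+ (2 ℕ.* attackers x) (12 ℕ.* n)) (cong₂ _+_ (fromℕ-* 2 (attackers x)) (fromℕ-* 12 n)))
          (fromℕ-mono-≤ (ℤ.drop‿+≤+ (subst₂ ℤ._≤_
            (sym (trans (ℤ.pos-* 3 (n ℕ.* n)) (cong (+ 3 ℤ.*_) (ℤ.pos-* n n))))
            (sym (cong₂ ℤ._+_ (ℤ.pos-* 2 (attackers x)) (ℤ.pos-* 12 n)))
            (attackers-≥ (proj₁ x) (proj₁ (proj₂ x)) (proj₂ (proj₂ x))))))

        -- The bound A ≥ 3ν²/2 - 6ν puts M at most 6ν above V g. The correction `d` takes off twice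
        -- as much, and the margin 6ν - 18 covers the cross terms.
        d = 1ℚ - fromℕ 12 * (ε * ε)
        g = 1ℚ - (+ 3 / 2) * ε

        0≤d : 0ℚ ≤ d
        0≤d = p≤q⇒0≤q-p (cε²≤1 (fromℕ 12))

        Md≤Vg : M * d ≤ V * g
        Md≤Vg = ≤-by
          (+-nonNeg (*-nonNeg (*-nonNeg (≤-dec 0ℚ ½) (p≤q⇒0≤q-p ≤A)) 0≤d)
            (+-nonNeg (*-nonNeg (≤-dec 0ℚ (fromℕ 6)) (+-nonNeg 0≤ν-13 (≤-dec 0ℚ (fromℕ 10)))) (*-nonNeg (≤-dec 0ℚ (fromℕ 72)) 0≤ε)))
          (trans (cong₂ (λ V M → V * g - M * d) V≡ν³ M≡ν³-A) (trans
            -- The solver treats `ν` and `ε` as independent. The difference is first arranged so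
            -- that they occur together as `ν * ε`, this product is replaced by 1, and a second call
            -- simplifies the rest.
            (solve 3 (λ ν e A →
                ν :* ν :* ν :* (con 1ℚ :- con (+ 3 / 2) :* e) :- (ν :* ν :* ν :- A) :* (con 1ℚ :- nat 12 :* (e :* e))
                := con ½ :* ((nat 2 :* A :+ nat 12 :* ν) :- nat 3 :* (ν :* ν)) :* (con 1ℚ :- nat 12 :* (e :* e)) :+
                   (con (+ 3 / 2) :* (ν :* ν) :* (con 1ℚ :- ν :* e) :+ nat 6 :* ν :* (nat 2 :* (ν :* e) :* (ν :* e) :- con 1ℚ)
                    :- nat 18 :* (ν :* e) :* (ν :* e) :+ nat 72 :* (ν :* e) :* e)) refl ν ε A)
            (cong (_+_ (½ * ((fromℕ 2 * A + fromℕ 12 * ν) - fromℕ 3 * (ν * ν)) * d)) (trans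
              (cong (λ p → (+ 3 / 2) * (ν * ν) * (1ℚ - p) + fromℕ 6 * ν * (fromℕ 2 * p * p - 1ℚ) - fromℕ 18 * p * p + fromℕ 72 * p * ε) νε≡1)
              (solve 2 (λ ν e →
                  con (+ 3 / 2) :* (ν :* ν) :* (con 1ℚ :- con 1ℚ) :+ nat 6 :* ν :* (nat 2 :* con 1ℚ :* con 1ℚ :- con 1ℚ)
                    :- nat 18 :* con 1ℚ :* con 1ℚ :+ nat 72 :* con 1ℚ :* e
                  := nat 6 :* ((ν :- nat 13) :+ nat 10) :+ nat 72 :* e) refl ν ε)))))

      -- With divisions cleared: c / C′ ≤ (M / V)^n ≤ (g / d)^n, where the n-th power of `d` is at
      -- least 1 - 12ε and that of `g` is at most 1 / E.
      choose-upper : ∀ K → fromℕ (m C n) * ((1ℚ - fromℕ 12 * ε) * expSum (+ 3 / 2) K) ≤ fromℕ ((n ℕ.^ 3) C n)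
      choose-upper K = begin
        c * ((1ℚ - fromℕ 12 * ε) * E)     ≡⟨ *-assoc c _ E ⟨
        c * (1ℚ - fromℕ 12 * ε) * E       ≤⟨ *-monoʳ 0≤E (*-monoˡ 0≤c (1-cε≤[1-cε²]^n (fromℕ 12))) ⟩
        c * d ^ n * E                 ≤⟨ *-monoʳ 0≤E cdⁿ≤Cgⁿ ⟩
        C′ * g ^ n * E                ≡⟨ *-assoc C′ (g ^ n) E ⟩
        C′ * (g ^ n * E)              ≤⟨ *-monoˡ 0≤C′ gⁿE≤1 ⟩
        C′ * 1ℚ                       ≡⟨ *-identityʳ C′ ⟩
        C′                            ∎
        where
        open ≤-Reasoning
        c = fromℕ (m C n)
        C′ = fromℕ ((n ℕ.^ 3) C n)
        E = expSum (+ 3 / 2) K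
        0≤c = 0≤fromℕ (m C n)
        0≤C′ = 0≤fromℕ ((n ℕ.^ 3) C n)
        0≤E = ≤-trans 0≤1 (1≤expSum (≤-dec 0ℚ (+ 3 / 2)) K)
        gⁿE≤1 : g ^ n * E ≤ 1ℚ
        gⁿE≤1 = subst (λ x → g ^ n * expSum x K ≤ 1ℚ)
          (trans (solve 3 (λ ν a e → ν :* (a :* e) := a :* (ν :* e)) refl ν (+ 3 / 2) ε)
                 (trans (cong ((+ 3 / 2) *_) νε≡1) (*-identityʳ (+ 3 / 2))))
          ([1-y]^n*expSum≤1 (*-nonNeg (≤-dec 0ℚ (+ 3 / 2)) 0≤ε) (cε≤1 (+ 3 / 2)) n K)
        cVⁿ≤C′Mⁿ : c * V ^ n ≤ C′ * M ^ n
        cVⁿ≤C′Mⁿ = subst₂ _≤_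
          (trans (fromℕ-* (m C n) ((n ℕ.^ 3) ℕ.^ n)) (cong (c *_) (fromℕ-^ (n ℕ.^ 3) n)))
          (trans (fromℕ-* ((n ℕ.^ 3) C n) (m ℕ.^ n)) (cong (C′ *_) (fromℕ-^ m n)))
          (fromℕ-mono-≤ (mCk*p^k≤pCk*m^k m≤n³ n))
        cdⁿ≤Cgⁿ : c * d ^ n ≤ C′ * g ^ n
        cdⁿ≤Cgⁿ = *-cancelʳ-≤-pos (V ^ n) {{positive (^-pos 0<V n)}} (begin
          c * d ^ n * V ^ n     ≡⟨ solve 3 (λ c d v → c :* d :* v := c :* v :* d) refl c (d ^ n) (V ^ n) ⟩
          c * V ^ n * d ^ n     ≤⟨ *-monoʳ (^-nonNeg 0≤d n) cVⁿ≤C′Mⁿ ⟩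
          C′ * M ^ n * d ^ n    ≡⟨ trans (*-assoc C′ (M ^ n) (d ^ n)) (cong (C′ *_) (sym (^-distrib-* M d n))) ⟩
          C′ * (M * d) ^ n      ≤⟨ *-monoˡ 0≤C′ (^-mono (*-nonNeg (0≤fromℕ m) 0≤d) Md≤Vg n) ⟩
          C′ * (V * g) ^ n      ≡⟨ cong (C′ *_) (^-distrib-* V g n) ⟩
          C′ * (V ^ n * g ^ n)  ≡⟨ solve 3 (λ c v g → c :* (v :* g) := c :* g :* v) refl C′ (V ^ n) (g ^ n) ⟩
          C′ * g ^ n * V ^ n    ∎)

      -- Here c / C′ ≥ ((m - n) / W)^n ≥ (g₃ d₄)^n. The power of `g₃` is compared with the
      -- exponential through `p`, since g₃ p = 1 - 9ε² is close to 1.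
      choose-lower : fromℕ ((n ℕ.^ 3) C n) * (1ℚ - fromℕ 13 * ε) ≤ fromℕ (m C n) * expSum (fromℕ 3) n
      choose-lower = begin
        C′ * (1ℚ - fromℕ 13 * ε)                       ≤⟨ *-monoˡ 0≤C′ 1-13ε≤ ⟩
        C′ * ((g₃ * (1ℚ + fromℕ 3 * ε)) ^ n * d₄ ^ n)  ≡⟨ cong (λ p → C′ * (p * d₄ ^ n)) (^-distrib-* g₃ (1ℚ + fromℕ 3 * ε) n) ⟩
        C′ * (g₃ ^ n * p ^ n * d₄ ^ n)             ≡⟨ solve 4 (λ C g p d → C :* (g :* p :* d) := C :* (g :* d) :* p) refl C′ (g₃ ^ n) (p ^ n) (d₄ ^ n) ⟩
        C′ * (g₃ ^ n * d₄ ^ n) * p ^ n             ≡⟨ cong (λ h → C′ * h * p ^ n) (^-distrib-* g₃ d₄ n) ⟨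
        C′ * (g₃ * d₄) ^ n * p ^ n                 ≤⟨ *-monoʳ (^-nonNeg 0≤p n) C′hⁿ≤c ⟩
        c * p ^ n                                  ≤⟨ *-monoˡ 0≤c pⁿ≤E ⟩
        c * expSum (fromℕ 3) n                         ∎
        where
        open ≤-Reasoning
        c = fromℕ (m C n)
        C′ = fromℕ ((n ℕ.^ 3) C n)
        0≤c = 0≤fromℕ (m C n)
        0≤C′ = 0≤fromℕ ((n ℕ.^ 3) C n)
        g₃ = 1ℚ - fromℕ 3 * ε
        -- The term 2ν in the bound for `A` has to be absorbed; the coefficient 4 does so and leaves
        -- a margin 2ν for the constant terms.
        d₄ = 1ℚ - fromℕ 4 * (ε * ε)
        p = 1ℚ + fromℕ 3 * ε
        0≤g₃ = p≤q⇒0≤q-p (cε≤1 (fromℕ 3))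
        0≤d₄ = p≤q⇒0≤q-p (cε²≤1 (fromℕ 4))
        0≤p : 0ℚ ≤ p
        0≤p = +-nonNeg 0≤1 (*-nonNeg (≤-dec 0ℚ (fromℕ 3)) 0≤ε)
        pⁿ≤E : p ^ n ≤ expSum (fromℕ 3) n
        pⁿ≤E = subst (λ x → p ^ n ≤ expSum x n)
          (trans (solve 3 (λ ν a e → ν :* (a :* e) := a :* (ν :* e)) refl ν (fromℕ 3) ε)
                 (trans (cong (fromℕ 3 *_) νε≡1) (*-identityʳ (fromℕ 3))))
          ([1+y]^n≤expSum (*-nonNeg (≤-dec 0ℚ (fromℕ 3)) 0≤ε) n)
        1-13ε≤ : 1ℚ - fromℕ 13 * ε ≤ (g₃ * p) ^ n * d₄ ^ n
        -- The 13 is 9 + 4: the price 9ε for replacing `g₃` by 1 / p, and 4ε for `d₄`.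
        1-13ε≤ = begin
          1ℚ - fromℕ 13 * ε                                ≤⟨ ≤-by (0≤cε² (fromℕ 36)) (solve 1 (λ e →
                                                            (con 1ℚ :- nat 9 :* e) :* (con 1ℚ :- nat 4 :* e) :- (con 1ℚ :- nat 13 :* e) := nat 36 :* (e :* e)) refl ε) ⟩
          (1ℚ - fromℕ 9 * ε) * (1ℚ - fromℕ 4 * ε)              ≤⟨ *-mono (^-nonNeg (p≤q⇒0≤q-p (cε²≤1 (fromℕ 9))) n) (p≤q⇒0≤q-p (cε≤1 (fromℕ 4)))
                                                            (1-cε≤[1-cε²]^n (fromℕ 9)) (1-cε≤[1-cε²]^n (fromℕ 4)) ⟩
          (1ℚ - fromℕ 9 * (ε * ε)) ^ n * d₄ ^ n            ≡⟨ cong (λ q → q ^ n * d₄ ^ n) (solve 1 (λ e →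
                                                            con 1ℚ :- nat 9 :* (e :* e) := (con 1ℚ :- nat 3 :* e) :* (con 1ℚ :+ nat 3 :* e)) refl ε) ⟩
          (g₃ * p) ^ n * d₄ ^ n                        ∎
        W = fromℕ (n ℕ.^ 3 ℕ.∸ n)
        W≡V-ν : W ≡ V - ν
        W≡V-ν = trans (solve 2 (λ W ν → W := (ν :+ W) :- ν) refl W ν)
          (cong (λ p → p - ν) (trans (sym (fromℕ-+ n (n ℕ.^ 3 ℕ.∸ n))) (cong fromℕ (ℕ.m+[n∸m]≡n (ℕ.m≤m*n n (n ℕ.^ 2) {{ℕ.m^n≢0 n 2}})))))
        0<W : 0ℚ < W
        0<W = subst (0ℚ <_) (sym W≡V-ν) 0<V-ν
        Wh≤m∸n : W * (g₃ * d₄) ≤ fromℕ (m ℕ.∸ n)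
        Wh≤m∸n = ≤-trans
          (≤-by (+-nonNeg (p≤q⇒0≤q-p A≤) (+-nonNeg (+-nonNeg (*-nonNeg (≤-dec 0ℚ (fromℕ 2)) 0≤ν-13) (≤-dec 0ℚ (fromℕ 10)))
                  (+-nonNeg 0≤1-13ε (+-nonNeg (*-nonNeg (≤-dec 0ℚ (fromℕ 9)) 0≤ε) (0≤cε² (fromℕ 12))))))
            (trans (cong₂ (λ W M → M - ν - W * (g₃ * d₄)) (trans W≡V-ν (cong (λ p → p - ν) V≡ν³)) M≡ν³-A) (trans
              (solve 3 (λ ν e A →
                  ν :* ν :* ν :- A :- ν :- (ν :* ν :* ν :- ν) :* ((con 1ℚ :- nat 3 :* e) :* (con 1ℚ :- nat 4 :* (e :* e)))
                  := ((nat 3 :* (ν :* ν) :+ nat 2 :* ν) :- A) :+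
                     (nat 3 :* (ν :* ν) :* (ν :* e :- con 1ℚ) :+ nat 2 :* ν :* (nat 2 :* (ν :* e) :* (ν :* e) :- con 1ℚ)
                       :- nat 12 :* (ν :* e) :* (ν :* e) :* (ν :* e) :- nat 3 :* (ν :* e) :- nat 4 :* (ν :* e) :* e
                       :+ nat 12 :* (ν :* e) :* (e :* e))) refl ν ε A)
              (cong (_+_ ((fromℕ 3 * (ν * ν) + fromℕ 2 * ν) - A)) (trans
                (cong (λ p → fromℕ 3 * (ν * ν) * (p - 1ℚ) + fromℕ 2 * ν * (fromℕ 2 * p * p - 1ℚ)
                               - fromℕ 12 * p * p * p - fromℕ 3 * p - fromℕ 4 * p * ε + fromℕ 12 * p * (ε * ε)) νε≡1)
                (solve 2 (λ ν e →
                    nat 3 :* (ν :* ν) :* (con 1ℚ :- con 1ℚ) :+ nat 2 :* ν :* (nat 2 :* con 1ℚ :* con 1ℚ :- con 1ℚ)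
                      :- nat 12 :* con 1ℚ :* con 1ℚ :* con 1ℚ :- nat 3 :* con 1ℚ :- nat 4 :* con 1ℚ :* e :+ nat 12 :* con 1ℚ :* (e :* e)
                    := (nat 2 :* (ν :- nat 13) :+ nat 10) :+ ((con 1ℚ :- nat 13 :* e) :+ (nat 9 :* e :+ nat 12 :* (e :* e)))) refl ν ε))))))
          (p-q≤p∸q m n)
        C′[m∸n]ⁿ≤cWⁿ : C′ * fromℕ (m ℕ.∸ n) ^ n ≤ c * W ^ n
        C′[m∸n]ⁿ≤cWⁿ = subst₂ _≤_
          (trans (fromℕ-* ((n ℕ.^ 3) C n) ((m ℕ.∸ n) ℕ.^ n)) (cong (C′ *_) (fromℕ-^ (m ℕ.∸ n) n)))
          (trans (fromℕ-* (m C n) ((n ℕ.^ 3 ℕ.∸ n) ℕ.^ n)) (cong (c *_) (fromℕ-^ (n ℕ.^ 3 ℕ.∸ n) n)))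
          (fromℕ-mono-≤ (pCk*[m∸l]^k≤mCk*[p∸l]^k m≤n³ n ℕ.≤-refl))
        C′hⁿ≤c : C′ * (g₃ * d₄) ^ n ≤ c
        C′hⁿ≤c = *-cancelʳ-≤-pos (W ^ n) {{positive (^-pos 0<W n)}} (begin
          C′ * (g₃ * d₄) ^ n * W ^ n     ≡⟨ solve 3 (λ c h w → c :* h :* w := c :* (w :* h)) refl C′ ((g₃ * d₄) ^ n) (W ^ n) ⟩
          C′ * (W ^ n * (g₃ * d₄) ^ n)   ≡⟨ cong (C′ *_) (^-distrib-* W (g₃ * d₄) n) ⟨
          C′ * (W * (g₃ * d₄)) ^ n       ≤⟨ *-monoˡ 0≤C′ (^-mono (*-nonNeg (<⇒≤ 0<W) (*-nonNeg 0≤g₃ 0≤d₄)) Wh≤m∸n n) ⟩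
          C′ * fromℕ (m ℕ.∸ n) ^ n       ≤⟨ C′[m∸n]ⁿ≤cWⁿ ⟩
          c * W ^ n                      ∎)

  -- Averaging over the spaces.

  module _ {A : Set} (f : A → ℕ) (c d : ℚ) where

    sum*≤ : (∀ x → fromℕ (f x) * c ≤ d) → ∀ xs → fromℕ (sum (map f xs)) * c ≤ fromℕ (length xs) * d
    sum*≤ fc≤d []       = ≤-reflexive (trans (*-zeroˡ c) (sym (*-zeroˡ d)))
    sum*≤ fc≤d (x ∷ xs) = begin
      fromℕ (f x ℕ.+ sum (map f xs)) * c             ≡⟨ cong (_* c) (fromℕ-+ (f x) (sum (map f xs))) ⟩
      (fromℕ (f x) + fromℕ (sum (map f xs))) * c     ≡⟨ *-distribʳ-+ c (fromℕ (f x)) (fromℕ (sum (map f xs))) ⟩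
      fromℕ (f x) * c + fromℕ (sum (map f xs)) * c   ≤⟨ +-mono-≤ (fc≤d x) (sum*≤ fc≤d xs) ⟩
      d + fromℕ (length xs) * d                      ≡⟨ trans (+-comm d _) (sym (fromℕ-suc-* (length xs) d)) ⟩
      fromℕ (suc (length xs)) * d                    ∎
      where open ≤-Reasoning

    ≤sum* : (∀ x → d ≤ fromℕ (f x) * c) → ∀ xs → fromℕ (length xs) * d ≤ fromℕ (sum (map f xs)) * c
    ≤sum* d≤fc []       = ≤-reflexive (trans (*-zeroˡ d) (sym (*-zeroˡ c)))
    ≤sum* d≤fc (x ∷ xs) = begin
      fromℕ (suc (length xs)) * d                    ≡⟨ trans (fromℕ-suc-* (length xs) d) (+-comm _ d) ⟩
      d + fromℕ (length xs) * d                      ≤⟨ +-mono-≤ (d≤fc x) (≤sum* d≤fc xs) ⟩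
      fromℕ (f x) * c + fromℕ (sum (map f xs)) * c   ≡⟨ *-distribʳ-+ c (fromℕ (f x)) (fromℕ (sum (map f xs))) ⟨
      (fromℕ (f x) + fromℕ (sum (map f xs))) * c     ≡⟨ cong (_* c) (fromℕ-+ (f x) (sum (map f xs))) ⟨
      fromℕ (f x ℕ.+ sum (map f xs)) * c             ∎
      where open ≤-Reasoning

  module _ (n : ℕ) .{{_ : ℕ.NonZero n}} where
    private
      F : Space n → ℕ
      F x = nonAttackers x C n
      Σ = sum (map F (spaces n))
      V = fromℕ (n ℕ.^ 3)
      L = fromℕ ((n ℕ.^ 3) C n)
      instance
        n³≢0 = n^3≢0 n
        configs≢0 = configurations≢0 n
        choices≢0 : ℕ.NonZero ((n ℕ.^ 3) C n)
        choices≢0 = subst ℕ.NonZero (length-configurations n) (configurations≢0 n)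
      0<VL : 0ℚ < V * L
      0<VL = positive⁻¹ (V * L) {{pos*pos⇒pos V {{positive (0<fromℕ (n ℕ.^ 3))}} L {{positive (0<fromℕ ((n ℕ.^ 3) C n))}}}}

    μ≡ : μ n ≡ fromℕ Σ * (+ 1 / ((n ℕ.^ 3) C n)) * (+ 1 / (n ℕ.^ 3))
    μ≡ = cong (_* (+ 1 / (n ℕ.^ 3))) (trans
      (/-cong (cong +_ (sum-numSafe n)) (length-configurations n))
      (/≡fromℕ* Σ ((n ℕ.^ 3) C n)))

    μ-nonNeg : 0ℚ ≤ μ n
    μ-nonNeg = subst (0ℚ ≤_) (sym μ≡)
      (*-nonNeg (*-nonNeg (0≤fromℕ Σ) (<⇒≤ (0<1/n ((n ℕ.^ 3) C n)))) (<⇒≤ (0<1/n (n ℕ.^ 3))))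

    private
      μ*VL≡Σ : μ n * (V * L) ≡ fromℕ Σ
      μ*VL≡Σ = trans (cong (_* (V * L)) μ≡) (trans
        (solve 5 (λ s l v V L → s :* l :* v :* (V :* L) := s :* (L :* l) :* (V :* v)) refl
           (fromℕ Σ) (+ 1 / ((n ℕ.^ 3) C n)) (+ 1 / (n ℕ.^ 3)) V L)
        (trans (cong₂ (λ p q → fromℕ Σ * p * q) (n*1/n ((n ℕ.^ 3) C n)) (n*1/n (n ℕ.^ 3)))
          (trans (*-identityʳ (fromℕ Σ * 1ℚ)) (*-identityʳ (fromℕ Σ)))))

      μ*c*VL≡Σ*c : ∀ c → μ n * c * (V * L) ≡ fromℕ Σ * c
      μ*c*VL≡Σ*c c = trans (solve 3 (λ m c v → m :* c :* v := m :* v :* c) refl (μ n) c (V * L)) (cong (_* c) μ*VL≡Σ)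

    μ-upper : 13 ℕ.≤ n → ∀ K → μ n * ((1ℚ - fromℕ 12 * (+ 1 / n)) * expSum (+ 3 / 2) K) ≤ 1ℚ
    μ-upper 13≤n K = *-cancelʳ-≤-pos (V * L) {{positive 0<VL}} (begin
      μ n * c * (V * L)             ≡⟨ μ*c*VL≡Σ*c c ⟩
      fromℕ Σ * c                   ≤⟨ sum*≤ F c L (λ x → choose-upper n 13≤n x K) (spaces n) ⟩
      fromℕ (length (spaces n)) * L ≡⟨ cong (λ l → fromℕ l * L) (length-spaces n) ⟩
      V * L                         ≡⟨ *-identityˡ (V * L) ⟨
      1ℚ * (V * L)                  ∎)
      where
      open ≤-Reasoning
      c = (1ℚ - fromℕ 12 * (+ 1 / n)) * expSum (+ 3 / 2) K

    μ-lower : 13 ℕ.≤ n → 1ℚ - fromℕ 13 * (+ 1 / n) ≤ μ n * expSum (fromℕ 3) n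
    μ-lower 13≤n = *-cancelʳ-≤-pos (V * L) {{positive 0<VL}} (begin
      w * (V * L)                         ≡⟨ solve 3 (λ w v l → w :* (v :* l) := v :* (l :* w)) refl w V L ⟩
      V * (L * w)                         ≡⟨ cong (λ l → fromℕ l * (L * w)) (length-spaces n) ⟨
      fromℕ (length (spaces n)) * (L * w) ≤⟨ ≤sum* F E (L * w) (choose-lower n 13≤n) (spaces n) ⟩
      fromℕ Σ * E                         ≡⟨ μ*c*VL≡Σ*c E ⟨
      μ n * E * (V * L)                   ∎)
      where
      open ≤-Reasoning
      w = 1ℚ - fromℕ 13 * (+ 1 / n)
      E = expSum (fromℕ 3) n

  -- Passage to the limit inferior and the limit superior.

  0≤1-c/n : ∀ {n} c .{{_ : ℕ.NonZero n}} → c ℕ.≤ n → 0ℚ ≤ 1ℚ - fromℕ c * (+ 1 / n)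
  0≤1-c/n {n} c c≤n = p≤q⇒0≤q-p (≤-trans (*-monoʳ (<⇒≤ (0<1/n n)) (fromℕ-mono-≤ c≤n)) (≤-reflexive (n*1/n n)))

  module _ {p s : ℚ} (0<p : 0ℚ < p) where
    private instance
      p≢0 : NonZero p
      p≢0 = >-nonZero 0<p

    1/p≤s⇒0≤s : 1/ p ≤ s → 0ℚ ≤ s
    1/p≤s⇒0≤s = ≤-trans (<⇒≤ (positive⁻¹ _ {{1/pos⇒pos p {{positive 0<p}}}}))

    1/p≤s⇒1≤s*p : 1/ p ≤ s → 1ℚ ≤ s * p
    1/p≤s⇒1≤s*p 1/p≤s = subst (_≤ s * p) (*-inverseˡ p) (*-monoʳ (<⇒≤ 0<p) 1/p≤s)

    s≤1/p⇒s*p≤1 : s ≤ 1/ p → s * p ≤ 1ℚ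
    s≤1/p⇒s*p≤1 s≤1/p = subst (s * p ≤_) (*-inverseˡ p) (*-monoʳ (<⇒≤ 0<p) s≤1/p)

  0<expSum : ∀ {x} → 0ℚ ≤ x → ∀ k → 0ℚ < expSum x k
  0<expSum 0≤x k = <-≤-trans (positive⁻¹ 1ℚ) (1≤expSum 0≤x k)

  0<q-p : ∀ {p q} → p < q → 0ℚ < q - p
  0<q-p {p} {q} p<q = subst (_< q - p) (+-inverseʳ p) (+-monoˡ-< (- p) p<q)

  -- The gap s - s′ pays for the loss 13 s / n. The comparison of `s` with 1 / E_n is assumed for
  -- each n separately, because the order of the sum varies with n.
  eventually-≤μ : ∀ {s s′} → s′ < s →
    ∃[ N ] (∀ n .{{_ : ℕ.NonZero n}} → N ℕ.≤ n → s * expSum (fromℕ 3) n ≤ 1ℚ → s′ ≤ μ n)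
  eventually-≤μ {s} {s′} s′<s = 13 ℕ.+ N₀ , bound
    where
    N₀ = proj₁ (eventually-*1/n≤ (fromℕ 13 * s) (0<q-p s′<s))
    isN₀ = proj₂ (eventually-*1/n≤ (fromℕ 13 * s) (0<q-p s′<s))
    bound : ∀ n .{{_ : ℕ.NonZero n}} → 13 ℕ.+ N₀ ℕ.≤ n → s * expSum (fromℕ 3) n ≤ 1ℚ → s′ ≤ μ n
    bound n large sE≤1 = *-cancelʳ-≤-pos E {{positive 0<E}} (begin
      s′ * E                       ≤⟨ *-monoʳ {s′} {s * (1ℚ - fromℕ 13 * ε)} (<⇒≤ 0<E) (≤-by (p≤q⇒0≤q-p (isN₀ n (ℕ.≤-trans (ℕ.m≤n+m N₀ 13) large)))
                                        (solve 3 (λ s s′ e → s :* (con 1ℚ :- nat 13 :* e) :- s′ := (s :- s′) :- nat 13 :* s :* e) refl s s′ ε)) ⟩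
      s * (1ℚ - fromℕ 13 * ε) * E      ≡⟨ solve 3 (λ s w e → s :* w :* e := w :* (s :* e)) refl s (1ℚ - fromℕ 13 * ε) E ⟩
      (1ℚ - fromℕ 13 * ε) * (s * E)    ≤⟨ *-monoˡ (0≤1-c/n 13 13≤n) sE≤1 ⟩
      (1ℚ - fromℕ 13 * ε) * 1ℚ         ≡⟨ *-identityʳ (1ℚ - fromℕ 13 * ε) ⟩
      1ℚ - fromℕ 13 * ε                ≤⟨ μ-lower n 13≤n ⟩
      μ n * E                      ∎)
      where
      open ≤-Reasoning
      ε = + 1 / n
      E = expSum (fromℕ 3) n
      0<E = 0<expSum (≤-dec 0ℚ (fromℕ 3)) n
      13≤n = ℕ.≤-trans (ℕ.m≤m+n 13 N₀) large

  eventually-μ≤ : ∀ {s s′} K → s < s′ → 0ℚ ≤ s → 1ℚ ≤ s * expSum (+ 3 / 2) K →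
    ∃[ N ] (∀ n .{{_ : ℕ.NonZero n}} → N ℕ.≤ n → μ n ≤ s′)
  -- Once n ≥ 24, (1 - 12/n) (1 + 24/n) ≥ 1, so dividing by 1 - 12/n can be replaced by multiplying
  -- by 1 + 24/n.
  eventually-μ≤ {s} {s′} K s<s′ 0≤s 1≤sE = 24 ℕ.+ N₀ , bound
    where
    N₀ = proj₁ (eventually-*1/n≤ (fromℕ 24 * s) (0<q-p s<s′))
    isN₀ = proj₂ (eventually-*1/n≤ (fromℕ 24 * s) (0<q-p s<s′))
    E = expSum (+ 3 / 2) K
    bound : ∀ n .{{_ : ℕ.NonZero n}} → 24 ℕ.+ N₀ ℕ.≤ n → μ n ≤ s′
    bound n large = begin
      μ n                                        ≤⟨ ≤-by (*-nonNeg (*-nonNeg (*-nonNeg (≤-dec 0ℚ (fromℕ 12)) 0≤ε) (0≤1-c/n 24 24≤n)) 0≤μ)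
                                                     (solve 2 (λ m e → m :* (con 1ℚ :- nat 12 :* e) :* (con 1ℚ :+ nat 24 :* e) :- m
                                                        := nat 12 :* e :* (con 1ℚ :- nat 24 :* e) :* m) refl (μ n) ε) ⟩
      μ n * w * (1ℚ + fromℕ 24 * ε)                  ≤⟨ *-monoʳ (+-nonNeg 0≤1 (*-nonNeg (≤-dec 0ℚ (fromℕ 24)) 0≤ε)) μw≤s ⟩
      s * (1ℚ + fromℕ 24 * ε)                        ≤⟨ ≤-by (p≤q⇒0≤q-p (isN₀ n (ℕ.≤-trans (ℕ.m≤n+m N₀ 24) large)))
                                                     (solve 3 (λ s s′ e → s′ :- s :* (con 1ℚ :+ nat 24 :* e) := (s′ :- s) :- nat 24 :* s :* e) refl s s′ ε) ⟩
      s′                                         ∎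
      where
      open ≤-Reasoning
      ε = + 1 / n
      w = 1ℚ - fromℕ 12 * ε
      0≤ε = <⇒≤ (0<1/n n)
      0≤μ = μ-nonNeg n
      24≤n : 24 ℕ.≤ n
      24≤n = ℕ.≤-trans (ℕ.m≤m+n 24 N₀) large
      μw≤s : μ n * w ≤ s
      μw≤s = begin
        μ n * w               ≡⟨ *-identityʳ (μ n * w) ⟨
        μ n * w * 1ℚ          ≤⟨ *-monoˡ (*-nonNeg 0≤μ (0≤1-c/n 12 (ℕ.≤-trans (ℕ.m≤m+n 12 12) 24≤n))) 1≤sE ⟩
        μ n * w * (s * E)     ≡⟨ solve 4 (λ m w s e → m :* w :* (s :* e) := s :* (m :* (w :* e))) refl (μ n) w s E ⟩
        s * (μ n * (w * E))   ≤⟨ *-monoˡ 0≤s (μ-upper n (ℕ.≤-trans (ℕ.m≤m+n 13 11) 24≤n) K) ⟩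
        s * 1ℚ                ≡⟨ *-identityʳ s ⟩
        s                     ∎

  -- The cut provides one `s` with s ≤ 1 / E_i for every i ≥ N, in particular for i = n, the order
  -- in `μ-lower`. A rational strictly between `q` and `s` leaves room for the error term.
  liminf-lower : lower (1/e^ (+ 3 / 1)) ≤ᴸ liminf (λ k → μ (suc k))
  liminf-lower {q} (N , s , q<s , s≤1/E) = N ℕ.+ N₀ , s′ , proj₁ (proj₂ (<-dense q<s)) , λ j →
      bound (suc (N ℕ.+ N₀ ℕ.+ j)) (ℕ.m≤n⇒m≤1+n (ℕ.m≤m+n (N ℕ.+ N₀) j))
    where
    s′ = proj₁ (<-dense q<s)
    large-n = eventually-≤μ (proj₂ (proj₂ (<-dense q<s)))
    N₀ = proj₁ large-n
    bound : ∀ n .{{_ : ℕ.NonZero n}} → N ℕ.+ N₀ ℕ.≤ n → s′ ≤ μ n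
    bound n large = proj₂ large-n n (ℕ.≤-trans (ℕ.m≤n+m N₀ N) large)
      (subst (λ i → s * expSum (fromℕ 3) i ≤ 1ℚ) (ℕ.m+[n∸m]≡n (ℕ.≤-trans (ℕ.m≤m+n N N₀) large))
        (s≤1/p⇒s*p≤1 {expSum (fromℕ 3) (N ℕ.+ (n ℕ.∸ N))} 0<E (s≤1/E (n ℕ.∸ N))))
      where
      0<E = 0<expSum (≤-dec 0ℚ (fromℕ 3)) (N ℕ.+ (n ℕ.∸ N))

  limsup-upper : limsup (λ k → μ (suc k)) ≤ᵁ upper (1/e^ (+ 3 / 2))
  limsup-upper {r} (N , s , s<r , 1/E≤s) = proj₁ large-n , s′ , proj₂ (proj₂ (<-dense s<r)) , λ j →
      proj₂ large-n (suc (proj₁ large-n ℕ.+ j)) (ℕ.m≤n⇒m≤1+n (ℕ.m≤m+n (proj₁ large-n) j))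
    where
    s′ = proj₁ (<-dense s<r)
    -- The first index of the tail provided by the cut is enough, since `μ-upper` holds for every
    -- order.
    E = expSum (+ 3 / 2) (N ℕ.+ 0)
    0<E = 0<expSum (≤-dec 0ℚ (+ 3 / 2)) (N ℕ.+ 0)
    large-n = eventually-μ≤ (N ℕ.+ 0) (proj₁ (proj₂ (<-dense s<r)))
      (1/p≤s⇒0≤s {E} 0<E (1/E≤s 0)) (1/p≤s⇒1≤s*p {E} 0<E (1/E≤s 0))

  -- The two tails, from `M` and from `N`, share the index M + N, where the bounds meet.
  liminf≤limsup : ∀ a → liminf a ≤ᴸᵁ limsup a
  liminf≤limsup a (M , s , q<s , s≤a) (N , t , t<r , a≤t) =
    <-≤-trans q<s (≤-trans (s≤a N) (≤-trans (≤-reflexive (cong a (ℕ.+-comm M N))) (<⇒≤ (≤-<-trans (a≤t M) t<r))))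

open Asymptotics using (liminf-lower; liminf≤limsup; limsup-upper)

mainTheorem8 : (lower (1/e^ (+ 3 / 1)) ≤ᴸ liminf (λ k → μ (suc k))) ×
    (liminf (λ k → μ (suc k)) ≤ᴸᵁ limsup (λ k → μ (suc k))) ×
    (limsup (λ k → μ (suc k)) ≤ᵁ upper (1/e^ (+ 3 / 2)))
mainTheorem8 = (λ {q} → liminf-lower {q}) , (λ {q} {r} → liminf≤limsup (λ k → μ (suc k)) {q} {r}) , λ {r} → limsup-upper {r}
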